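{- $$F_{213}(x,y)=\frac{1-x^2+x^2y-\sqrt{1+2x^2-2x^2y+x^4-2x^4y+x^4y^2-4x}}{2x(1+xy-x)}.$$
   Context: The pattern $213$ is written without dashes, so an occurrence of $213$ in $\pi=\pi_1\cdots\pi_n\in S_n$ is a position $i$ with $\pi_{i+1}<\pi_i<\pi_{i+2}$. A permutation is $1\text{ - }3\text{ - }2$-avoiding if there are no positions $a<b<c$ with $\pi_a<\pi_c<\pi_b$. $f_{\tau;r}(n)$ is the number of $1\text{ - }3\text{ - }2$-avoiding permutations in $S_n$ containing exactly $r$ occurrences of $\tau$ (with $S_0$ consisting of the empty permutation), and $F_\tau(x,y)=\sum_{n,r\ge 0} f_{\tau;r}(n)x^ny^r$, a formal power series in $x$ with coefficients in $\mathbb Z[y]$. The square root denotes the formal power series in $x$ with constant term $1$. -}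

module Defs where

open import Algebra.Bundles using (RawRing)
import Algebra.Definitions.RawMonoid as RawMonoidDefs
import Algebra.Definitions.RawSemiring as RawSemiringDefs
import Algebra.Properties.Monoid.Sum as MonoidSum
open import Data.Fin.Base as Fin using (Fin; toℕ)
open import Data.Fin.Properties as Fin using (any?)
open import Data.Integer.Base as ℤ using (ℤ; +_)
import Data.Integer.Properties as ℤ
open import Data.List.Base as List
  using (List; []; _∷_; allFin; cartesianProductWith; filter; length)
open import Data.List.Properties using (length-filter; length-tabulate; filter-none)
open import Data.List.Relation.Unary.All as All using (All)
open import Data.Nat.Base as ℕ using (ℕ; zero; suc; _∸_; z≤n; s≤s)
import Data.Nat.Properties as ℕ
open import Data.Product.Base using (∃; ∃-syntax; Σ-syntax; _×_; _,_; proj₁; proj₂)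
open import Data.Vec.Base as Vec using (Vec; []; _∷_; lookup)
open import Data.Vec.Relation.Unary.AllPairs using (allPairs?)
open import Data.Vec.Relation.Unary.Unique.Propositional using (Unique)
open import Function.Base using (_∘_)
open import Relation.Binary.PropositionalEquality
  using (_≡_; refl; sym; trans; cong; cong₂; subst)
open import Relation.Nullary using (¬_; Dec; yes; no)
open import Relation.Nullary.Decidable using (¬?; _×-dec_)

-- Words of length k over {0 < … < n-1}; a permutation in S_n is a word
-- π : Vec (Fin n) n (one-line notation) without repeated letters.

words : ∀ n k → List (Vec (Fin n) k)
words n zero    = [] ∷ []
words n (suc k) = cartesianProductWith _∷_ (allFin n) (words n k)

IsPermutation : ∀ {n} → Vec (Fin n) n → Set
IsPermutation π = Unique π

isPermutation? : ∀ {n} (π : Vec (Fin n) n) → Dec (IsPermutation π)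
isPermutation? = allPairs? (λ i j → ¬? (i Fin.≟ j))

Contains1-3-2 : ∀ {n} → Vec (Fin n) n → Set
Contains1-3-2 π = ∃[ a ] ∃[ b ] ∃[ c ]
  (a Fin.< b × b Fin.< c ×
   lookup π a Fin.< lookup π c × lookup π c Fin.< lookup π b)

contains1-3-2? : ∀ {n} (π : Vec (Fin n) n) → Dec (Contains1-3-2 π)
contains1-3-2? π = any? λ a → any? λ b → any? λ c →
  (a Fin.<? b) ×-dec (b Fin.<? c) ×-dec
  (lookup π a Fin.<? lookup π c) ×-dec (lookup π c Fin.<? lookup π b)

Avoids1-3-2 : ∀ {n} → Vec (Fin n) n → Set
Avoids1-3-2 π = ¬ Contains1-3-2 π

-- The three positions are i, j = i + 1 and k = i + 2.

Occurs213At : ∀ {n} → Vec (Fin n) n → Fin n → Set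
Occurs213At π i = ∃[ j ] ∃[ k ]
  (toℕ j ≡ suc (toℕ i) × toℕ k ≡ suc (toℕ j) ×
   lookup π j Fin.< lookup π i × lookup π i Fin.< lookup π k)

occurs213At? : ∀ {n} (π : Vec (Fin n) n) (i : Fin n) → Dec (Occurs213At π i)
occurs213At? π i = any? λ j → any? λ k →
  (toℕ j ℕ.≟ suc (toℕ i)) ×-dec (toℕ k ℕ.≟ suc (toℕ j)) ×-dec
  (lookup π j Fin.<? lookup π i) ×-dec (lookup π i Fin.<? lookup π k)

occurrences213 : ∀ {n} → Vec (Fin n) n → ℕ
occurrences213 {n} π = length (filter (occurs213At? π) (allFin n))

Counted : ∀ {n} → ℕ → Vec (Fin n) n → Set
Counted r π = IsPermutation π × Avoids1-3-2 π × occurrences213 π ≡ r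

counted? : ∀ {n} r (π : Vec (Fin n) n) → Dec (Counted r π)
counted? r π =
  isPermutation? π ×-dec ¬? (contains1-3-2? π) ×-dec (occurrences213 π ℕ.≟ r)

f₂₁₃ : ℕ → ℕ → ℕ
f₂₁₃ n r = length (filter (counted? r) (words n n))

f₂₁₃-vanishes : ∀ n r → suc n ℕ.≤ r → f₂₁₃ n r ≡ 0
f₂₁₃-vanishes n r n<r =
  cong length (filter-none (counted? r) (All.universal notCounted (words n n)))
  where
  bound : (π : Vec (Fin n) n) → occurrences213 π ℕ.≤ n
  bound π = subst (occurrences213 π ℕ.≤_) (length-tabulate {n = n} (λ i → i))
    (length-filter (occurs213At? π) (allFin n))

  notCounted : (π : Vec (Fin n) n) → ¬ Counted r π
  notCounted π (_ , _ , occ≡r) =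
    ℕ.<⇒≱ n<r (subst (ℕ._≤ n) occ≡r (bound π))

-- Formal power series in one variable over R: a n is the coefficient of the
-- n-th power of the variable, and multiplication is the Cauchy product.

module _ {c ℓ} (R : RawRing c ℓ) where
  private
    module R = RawRing R
  open RawMonoidDefs R.+-rawMonoid using (sum)

  convolve : (a b : ℕ → R.Carrier) → ℕ → R.Carrier
  convolve a b n = sum {suc n} λ i → a (toℕ i) R.* b (n ∸ toℕ i)

  constant : R.Carrier → ℕ → R.Carrier
  constant u zero    = u
  constant u (suc _) = R.0#

  indeterminate : ℕ → R.Carrier
  indeterminate zero    = R.0#
  indeterminate (suc n) = constant R.1# n

  powerSeries : RawRing c ℓ
  powerSeries = record
    { Carrier = ℕ → R.Carrier
    ; _≈_     = λ a b → ∀ n → a n R.≈ b n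
    ; _+_     = λ a b n → a n R.+ b n
    ; _*_     = convolve
    ; -_      = λ a n → R.- a n
    ; 0#      = λ _ → R.0#
    ; 1#      = constant R.1#
    }

-- ℤ[y] is the subring of finitely supported elements of ℤ⟦y⟧.

ℤ-rawRing : RawRing _ _
ℤ-rawRing = ℤ.+-*-rawRing

ℤ⟦y⟧ : RawRing _ _
ℤ⟦y⟧ = powerSeries ℤ-rawRing

FinitelySupported : (ℕ → ℤ) → Set
FinitelySupported p = ∃[ d ] (∀ k → d ℕ.≤ k → p k ≡ ℤ.0ℤ)

record Polynomial : Set where
  constructor polynomial
  field
    coeff    : ℕ → ℤ
    finitely : FinitelySupported coeff

open Polynomial public

module _ where
  private
    module P = RawRing ℤ⟦y⟧
    open MonoidSum ℤ.+-0-monoid using (sum; sum-cong-≋; sum-replicate-zero)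

  +-finitely : ∀ {p q} → FinitelySupported p → FinitelySupported q →
               FinitelySupported (p P.+ q)
  +-finitely (d , p≡0) (e , q≡0) = d ℕ.+ e , λ k d+e≤k →
    cong₂ ℤ._+_ (p≡0 k (ℕ.m+n≤o⇒m≤o d d+e≤k)) (q≡0 k (ℕ.m+n≤o⇒n≤o d d+e≤k))

  neg-finitely : ∀ {p} → FinitelySupported p → FinitelySupported (P.- p)
  neg-finitely (d , p≡0) = d , λ k d≤k → cong ℤ.-_ (p≡0 k d≤k)

  *-finitely : ∀ {p q} → FinitelySupported p → FinitelySupported q →
               FinitelySupported (p P.* q)
  *-finitely {p} {q} (d , p≡0) (e , q≡0) = d ℕ.+ e , λ k d+e≤k →
    trans (sum-cong-≋ (term k d+e≤k)) (sum-replicate-zero (suc k))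
    where
    term : ∀ k → d ℕ.+ e ℕ.≤ k → (i : Fin (suc k)) →
           p (toℕ i) ℤ.* q (k ∸ toℕ i) ≡ ℤ.0ℤ
    term k d+e≤k i with d ℕ.≤? toℕ i
    ... | yes d≤i = trans (cong (ℤ._* q (k ∸ toℕ i)) (p≡0 (toℕ i) d≤i))
                          (ℤ.*-zeroˡ (q (k ∸ toℕ i)))
    ... | no  d≰i = trans (cong (p (toℕ i) ℤ.*_) (q≡0 (k ∸ toℕ i) e≤k∸i))
                          (ℤ.*-zeroʳ (p (toℕ i)))
      where
      e≤k∸i : e ℕ.≤ k ∸ toℕ i
      e≤k∸i = ℕ.m+n≤o⇒m≤o∸n e
        (ℕ.≤-trans (ℕ.+-monoʳ-≤ e (ℕ.<⇒≤ (ℕ.≰⇒> d≰i)))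
                   (subst (ℕ._≤ k) (ℕ.+-comm d e) d+e≤k))

  ℤ[y] : RawRing _ _
  ℤ[y] = record
    { Carrier = Polynomial
    ; _≈_     = λ p q → coeff p P.≈ coeff q
    ; _+_     = λ p q → polynomial (coeff p P.+ coeff q)
                                   (+-finitely (finitely p) (finitely q))
    ; _*_     = λ p q → polynomial (coeff p P.* coeff q)
                                   (*-finitely (finitely p) (finitely q))
    ; -_      = λ p → polynomial (P.- coeff p) (neg-finitely (finitely p))
    ; 0#      = polynomial P.0# (0 , λ _ _ → refl)
    ; 1#      = polynomial P.1# (1 , λ { (suc _) _ → refl })
    }

ℤ[y]⟦x⟧ : RawRing _ _
ℤ[y]⟦x⟧ = powerSeries ℤ[y]

open RawRing ℤ[y]⟦x⟧ public using (_≈_; _≉_; _+_; _*_; -_; 0#; 1#)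
  renaming (Carrier to Series)
open RawSemiringDefs (RawRing.rawSemiring ℤ[y]⟦x⟧) public using (_^_)
  renaming (_×_ to _·_)

infixl 6 _-_
_-_ : Series → Series → Series
a - b = a + (- b)

x : Series
x = indeterminate ℤ[y]

y : Series
y = constant ℤ[y]
  (polynomial (indeterminate ℤ-rawRing) (2 , λ { (suc (suc _)) _ → refl
                                           ; (suc zero) (s≤s ()) }))

F₂₁₃ : Series
F₂₁₃ n = polynomial (λ r → + f₂₁₃ n r)
  (suc n , λ r n<r → cong +_ (f₂₁₃-vanishes n r n<r))

-- ℤ[y]⟦x⟧ is an integral domain of characteristic 0, so each of the following
-- two relations determines s, respectively g, uniquely.

IsSqrt : Series → Series → Set
IsSqrt a s = s * s ≈ a × RawRing._≈_ ℤ[y] (s 0) (RawRing.1# ℤ[y])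

infix 4 _≈_/_
_≈_/_ : Series → Series → Series → Set
g ≈ a / b = b ≉ 0# × b * g ≈ a

-- Write a nonempty 1-3-2-avoiding permutation as L m R with m its maximum: every letter of L
-- exceeds every letter of R, and L, R are arbitrary 1-3-2-avoiding permutations up to order
-- isomorphism. Besides the occurrences of 213 inside L and R there is one more, ending in m,
-- exactly when L ends in a descent. So let D be the generating function of the avoiders ending
-- in a descent and A = F + (y - 1) D that of all avoiders with a final descent counted as an
-- extra occurrence. Then F = 1 + x A F and D = x A (D + x), where the last x accounts for a
-- one-letter R. Both x F and D + x solve T = x + x A T, hence D = x F - x, and eliminating A
-- and D leaves the quadratic x (1 + x y - x) F² - (1 - x² + x² y) F + 1 = 0 with discriminant Δ.
module Submission where

open import Defs hiding (_+_; _*_; -_; _-_; 0#; 1#; _≈_; _≉_; _^_; _·_; x; y)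
open import Algebra.Bundles using (CommutativeRing; RawRing)
open import Algebra.Core using (Op₂)
import Algebra.Definitions.RawSemiring as RawSemiringDefs
import Algebra.Morphism.RingMonomorphism as RingMonomorphism
open import Algebra.Morphism.Structures using (IsRingMonomorphism)
import Algebra.Properties.CommutativeSemigroup as CommutativeSemigroupProperties
import Algebra.Properties.Group as GroupProperties
import Algebra.Properties.Semiring.Exp as Exp
import Algebra.Properties.Semiring.Mult as Mult
import Algebra.Properties.Semiring.Sum as Sum
import Algebra.Solver.Ring.NaturalCoefficients.Default as NaturalCoefficients
open import Data.Bool.Base using (true; false; if_then_else_)
open import Data.Fin.Base as Fin using (Fin; toℕ; zero; suc; fromℕ<)
import Data.Fin.Properties as Fin
import Data.Integer.Base as ℤ
import Data.Integer.Properties as ℤ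
open import Data.List.Base as List
  using (List; []; _∷_; _++_; map; length; filter; tabulate; allFin; concat; cartesianProduct)
open import Data.List.Membership.Propositional using (_∈_)
open import Data.List.Membership.Propositional.Properties
  using (∈-∃++; ∈-lookup; ∈-map⁺; ∈-map⁻; ∈-filter⁻; ∈-filter⁺; ∈-cartesianProduct⁺;
         ∈-cartesianProduct⁻; ∈-concat⁺′; ∈-concat⁻′; ∈-tabulate⁺; ∈-tabulate⁻;
         ∈-cartesianProductWith⁺; ∈-allFin)
open import Data.List.Membership.Propositional.Properties.WithK using (unique∧set⇒bag)
import Data.List.Properties as List
open import Data.List.Relation.Binary.BagAndSetEquality using (∼bag⇒↭)
open import Data.List.Relation.Binary.Permutation.Propositional as ↭ using (_↭_; prep; swap)
open import Data.List.Relation.Unary.All as All using (All; []; _∷_)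
import Data.List.Relation.Unary.All.Properties as All
open import Data.List.Relation.Unary.AllPairs as AllPairs using (AllPairs; []; _∷_)
import Data.List.Relation.Unary.AllPairs.Properties as AllPairs
open import Data.List.Relation.Unary.Any as Any using (here; there)
open import Data.List.Relation.Unary.Unique.Propositional using (Unique)
import Data.List.Relation.Unary.Unique.Propositional.Properties as Unique
open import Data.Nat.Base as ℕ using (ℕ; zero; suc; 2+; _∸_; _<_; _≤_; s≤s; s<s; z<s; s≤s⁻¹)
import Data.Nat.Properties as ℕ
open import Data.Nat.Properties using (_<?_; _≟_)
open import Data.Product.Base using (∃; ∃₂; ∃-syntax; _×_; _,_; proj₁; proj₂; uncurry)
open import Data.Sum.Base using (_⊎_; inj₁; inj₂)
open import Data.Unit.Base using (⊤; tt)
open import Data.Vec.Base as Vec using (Vec; []; _∷_; lookup)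
import Data.Vec.Relation.Unary.All as VecAll
import Data.Vec.Relation.Unary.All.Properties as VecAll
open import Data.Vec.Relation.Unary.AllPairs using ([]; _∷_)
import Data.Vec.Relation.Unary.Unique.Propositional as Vec
open import Function.Base using (_∘_; id; case_of_)
open import Function.Bundles using (_⇔_; mk⇔; module Equivalence)
open import Level using (Level; _⊔_)
open import Relation.Binary.Core using (Rel)
open import Relation.Binary.PropositionalEquality as ≡
  using (_≡_; _≢_; cong; cong₂; subst; subst₂; module ≡-Reasoning)
import Relation.Binary.Reasoning.Setoid as ≈-Reasoning
open import Relation.Nullary using (¬_; Dec; yes; no; does; contradiction)
open import Relation.Nullary.Decidable using (¬?; _×-dec_; does-⇔; dec-true; dec-false)
open import Relation.Unary using (Pred; Decidable)

-- Formal power series over a commutative ring.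

module PowerSeries {c ℓ} (R : CommutativeRing c ℓ) where
  open CommutativeRing R hiding (zero)
  open ≈-Reasoning setoid
  open CommutativeSemigroupProperties +-commutativeSemigroup
    using (interchange; x∙yz≈y∙xz)
  module ⟦x⟧ = RawRing (powerSeries rawRing)
  open ⟦x⟧ using () renaming (_≈_ to _≋_; _+_ to _⊕_; _*_ to _⊛_; 1# to 𝟙)

  private
    variable
      a a′ b b′ d : ⟦x⟧.Carrier

  ⊛-cong : a ≋ a′ → b ≋ b′ → (a ⊛ b) ≋ (a′ ⊛ b′)
  ⊛-cong a≋a′ b≋b′ zero    = +-congʳ (*-cong (a≋a′ 0) (b≋b′ 0))
  ⊛-cong a≋a′ b≋b′ (suc n) =
    +-cong (*-cong (a≋a′ 0) (b≋b′ (suc n))) (⊛-cong (a≋a′ ∘ suc) b≋b′ n)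

  ⊛-zeroˡ : ∀ b → (⟦x⟧.0# ⊛ b) ≋ ⟦x⟧.0#
  ⊛-zeroˡ b zero    = trans (+-identityʳ _) (zeroˡ _)
  ⊛-zeroˡ b (suc n) = trans (+-cong (zeroˡ _) (⊛-zeroˡ b n)) (+-identityʳ 0#)

  ⊛-identityˡ : ∀ b → (𝟙 ⊛ b) ≋ b
  ⊛-identityˡ b zero    = trans (+-identityʳ _) (*-identityˡ _)
  ⊛-identityˡ b (suc n) =
    trans (+-cong (*-identityˡ _) (⊛-zeroˡ b n)) (+-identityʳ _)

  -- The Cauchy product unfolds by peeling the constant term off its left factor. This is the mirror
  -- recursion on the right factor, and comparing the two gives commutativity by induction.
  ⊛-sucʳ : ∀ a b n → (a ⊛ b) (suc n) ≈ a (suc n) * b 0 + (a ⊛ (b ∘ suc)) n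
  ⊛-sucʳ a b zero    = begin
    a 0 * b 1 + (a 1 * b 0 + 0#)  ≈⟨ x∙yz≈y∙xz _ _ _ ⟩
    a 1 * b 0 + (a 0 * b 1 + 0#)  ∎
  ⊛-sucʳ a b (suc n) = begin
    a 0 * b (2+ n) + ((a ∘ suc) ⊛ b) (suc n)
      ≈⟨ +-congˡ (⊛-sucʳ (a ∘ suc) b n) ⟩
    a 0 * b (2+ n) + (a (2+ n) * b 0 + ((a ∘ suc) ⊛ (b ∘ suc)) n)
      ≈⟨ x∙yz≈y∙xz _ _ _ ⟩
    a (2+ n) * b 0 + (a ⊛ (b ∘ suc)) (suc n)  ∎

  ⊛-comm : ∀ a b → (a ⊛ b) ≋ (b ⊛ a)
  ⊛-comm a b zero    = +-congʳ (*-comm (a 0) (b 0))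
  ⊛-comm a b (suc n) = trans (+-cong (*-comm (a 0) (b (suc n))) (⊛-comm (a ∘ suc) b n))
                             (sym (⊛-sucʳ b a n))

  ⊛-distribʳ-⊕ : ∀ d a b → ((a ⊕ b) ⊛ d) ≋ ((a ⊛ d) ⊕ (b ⊛ d))
  ⊛-distribʳ-⊕ d a b zero    = begin
    (a 0 + b 0) * d 0 + 0#               ≈⟨ +-cong (distribʳ _ _ _) (sym (+-identityʳ 0#)) ⟩
    (a 0 * d 0 + b 0 * d 0) + (0# + 0#)  ≈⟨ interchange _ _ _ _ ⟩
    (a ⊛ d) 0 + (b ⊛ d) 0                ∎
  ⊛-distribʳ-⊕ d a b (suc n) =
    trans (+-cong (distribʳ _ _ _) (⊛-distribʳ-⊕ d (a ∘ suc) (b ∘ suc) n))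
          (interchange _ _ _ _)

  ⊛-distribˡ-⊕ : ∀ d a b → (d ⊛ (a ⊕ b)) ≋ ((d ⊛ a) ⊕ (d ⊛ b))
  ⊛-distribˡ-⊕ d a b n = begin
    (d ⊛ (a ⊕ b)) n        ≈⟨ ⊛-comm d (a ⊕ b) n ⟩
    ((a ⊕ b) ⊛ d) n        ≈⟨ ⊛-distribʳ-⊕ d a b n ⟩
    (a ⊛ d) n + (b ⊛ d) n  ≈⟨ +-cong (⊛-comm a d n) (⊛-comm b d n) ⟩
    (d ⊛ a) n + (d ⊛ b) n  ∎

  -- For associativity: the tail of `a ⊛ b` is `b ∘ suc` scaled by `a 0`, plus the product of the
  -- tail of `a` with `b`.
  ⊛-scale : ∀ u a b n → ((λ i → u * a i) ⊛ b) n ≈ u * (a ⊛ b) n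
  ⊛-scale u a b zero    = begin
    u * a 0 * b 0 + 0#        ≈⟨ +-cong (*-assoc u (a 0) (b 0)) (sym (zeroʳ u)) ⟩
    u * (a 0 * b 0) + u * 0#  ≈⟨ distribˡ u _ _ ⟨
    u * (a 0 * b 0 + 0#)      ∎
  ⊛-scale u a b (suc n) =
    trans (+-cong (*-assoc u (a 0) (b (suc n))) (⊛-scale u (a ∘ suc) b n))
          (sym (distribˡ u _ _))

  ⊛-assoc : ∀ a b d → ((a ⊛ b) ⊛ d) ≋ (a ⊛ (b ⊛ d))
  ⊛-assoc a b d zero    = +-congʳ (begin
    (a 0 * b 0 + 0#) * d 0  ≈⟨ *-congʳ (+-identityʳ _) ⟩
    a 0 * b 0 * d 0         ≈⟨ *-assoc _ _ _ ⟩
    a 0 * (b 0 * d 0)       ≈⟨ *-congˡ (+-identityʳ _) ⟨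
    a 0 * (b 0 * d 0 + 0#)  ∎)
  ⊛-assoc a b d (suc n) = begin
    (a 0 * b 0 + 0#) * d (suc n) + (((a ⊛ b) ∘ suc) ⊛ d) n
      ≈⟨ +-cong (trans (*-congʳ (+-identityʳ _)) (*-assoc _ _ _))
                (⊛-distribʳ-⊕ d (λ i → a 0 * b (suc i)) ((a ∘ suc) ⊛ b) n) ⟩
    a 0 * (b 0 * d (suc n)) + (((λ i → a 0 * b (suc i)) ⊛ d) n + (((a ∘ suc) ⊛ b) ⊛ d) n)
      ≈⟨ +-congˡ (+-cong (⊛-scale (a 0) (b ∘ suc) d n) (⊛-assoc (a ∘ suc) b d n)) ⟩
    a 0 * (b 0 * d (suc n)) + (a 0 * ((b ∘ suc) ⊛ d) n + ((a ∘ suc) ⊛ (b ⊛ d)) n)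
      ≈⟨ +-assoc _ _ _ ⟨
    a 0 * (b 0 * d (suc n)) + a 0 * ((b ∘ suc) ⊛ d) n + ((a ∘ suc) ⊛ (b ⊛ d)) n
      ≈⟨ +-congʳ (distribˡ _ _ _) ⟨
    (a ⊛ (b ⊛ d)) (suc n)  ∎

  commutativeRing : CommutativeRing c ℓ
  commutativeRing = record
    { RawRing (powerSeries rawRing)
    ; isCommutativeRing = record
      { isRing = record
        { +-isAbelianGroup = record
          { isGroup = record
            { isMonoid = record
              { isSemigroup = record
                { isMagma = record
                  { isEquivalence = record
                    { refl  = λ _ → refl
                    ; sym   = λ a≋b n → sym (a≋b n)
                    ; trans = λ a≋b b≋d n → trans (a≋b n) (b≋d n)
                    }
                  ; ∙-cong = λ a≋a′ b≋b′ n → +-cong (a≋a′ n) (b≋b′ n)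
                  }
                ; assoc = λ a b d n → +-assoc (a n) (b n) (d n)
                }
              ; identity = (λ a n → +-identityˡ (a n)) , (λ a n → +-identityʳ (a n))
              }
            ; inverse = (λ a n → -‿inverseˡ (a n)) , (λ a n → -‿inverseʳ (a n))
            ; ⁻¹-cong = λ a≋b n → -‿cong (a≋b n)
            }
          ; comm = λ a b n → +-comm (a n) (b n)
          }
        ; *-cong     = ⊛-cong
        ; *-assoc    = ⊛-assoc
        ; *-identity = ⊛-identityˡ
                     , λ a n → trans (⊛-comm a 𝟙 n) (⊛-identityˡ a n)
        ; distrib    = ⊛-distribˡ-⊕ , ⊛-distribʳ-⊕
        }
      ; *-comm = ⊛-comm
      }
    }

  constant-* : ∀ u b n → (constant rawRing u ⊛ b) n ≈ u * b n
  constant-* u b zero    = +-identityʳ _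
  constant-* u b (suc n) = trans (+-congˡ (⊛-zeroˡ b n)) (+-identityʳ _)

  indeterminate-*-zero : ∀ b → (indeterminate rawRing ⊛ b) 0 ≈ 0#
  indeterminate-*-zero b = trans (+-identityʳ _) (zeroˡ (b 0))

  indeterminate-*-suc : ∀ b n → (indeterminate rawRing ⊛ b) (suc n) ≈ b n
  indeterminate-*-suc b n = begin
    0# * b (suc n) + (constant rawRing 1# ⊛ b) n  ≈⟨ +-cong (zeroˡ _) (⊛-identityˡ b n) ⟩
    0# + b n                                      ≈⟨ +-identityˡ _ ⟩
    b n                                           ∎

-- Parametrised by the operations rather than by a ring, so that a solution over a CommutativeRing
-- is one over the series of Defs by comparing the operations, not the (huge) unfolded equations.
record IsSolution {c ℓ} {C : Set c} (_≈_ : Rel C ℓ) (_+_ _*_ _-_ : Op₂ C)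
                  (_^_ : C → ℕ → C) (_·_ : ℕ → C → C) (1# x y F s : C) : Set (c ⊔ ℓ) where
  field
    square : (s * s) ≈
      ((((((1# + (2 · (x ^ 2))) - ((2 · (x ^ 2)) * y)) + (x ^ 4)) - ((2 · (x ^ 4)) * y))
        + ((x ^ 4) * (y ^ 2))) - (4 · x))
    constant-term : ∃[ w ] s ≈ (1# + (x * w))
    quotient : (((2 · x) * ((1# + (x * y)) - x)) * F) ≈ (((1# - (x ^ 2)) + ((x ^ 2) * y)) - s)

-- The quadratic equation and its discriminant.

module QuadraticEquation {c ℓ} (R : CommutativeRing c ℓ) where
  open CommutativeRing R
  open RawSemiringDefs (RawRing.rawSemiring rawRing) using (_^_) renaming (_×_ to _·_)
  open GroupProperties +-group using (∙-cancelʳ; x≈z//y; //-rightDividesˡ)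
  open NaturalCoefficients commutativeSemiring
    using (solve; con; _:=_; _:+_; _:*_; _:^_) renaming (Polynomial to Expression)
  open ≈-Reasoning setoid

  b≈a-[a-b] : ∀ a b → b ≈ a - (a - b)
  b≈a-[a-b] a b = x≈z//y _ _ _ (trans (+-comm b (a - b)) (//-rightDividesˡ b a))

  -- The quadratic formula read backwards: the root is defined from `F`, so the quotient relation is
  -- immediate and the work lies in computing its square and its constant term.
  √Δ : Carrier → Carrier → Carrier → Carrier
  √Δ x y F = 1# - x ^ 2 + x ^ 2 * y - 2 · x * (1# + x * y - x) * F

  -- The hypothesis says that m² - 2am is -e. The solver knows only semiring identities, so the
  -- difference `s` enters solely through `s + m ≈ a`, and a common summand is cancelled at the end.
  square-of-difference : ∀ {a m e} → m * m + e ≈ a * m + a * m →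
                         (a - m) * (a - m) ≈ a * a - e
  square-of-difference {a} {m} {e} eq = x≈z//y _ _ _ (∙-cancelʳ (s * m + (s + m) * m) _ _ (begin
    s * s + e + (s * m + (s + m) * m)
      ≈⟨ solve 3 (λ s m e → s :* s :+ e :+ (s :* m :+ (s :+ m) :* m)
           := s :* s :+ (s :* m :+ s :* m) :+ (m :* m :+ e)) refl s m e ⟩
    s * s + (s * m + s * m) + (m * m + e)
      ≈⟨ +-congˡ eq ⟩
    s * s + (s * m + s * m) + (a * m + a * m)
      ≈⟨ +-congˡ (+-cong (*-congʳ s+m≈a) (*-congʳ s+m≈a)) ⟨
    s * s + (s * m + s * m) + ((s + m) * m + (s + m) * m)
      ≈⟨ solve 2 (λ s m → s :* s :+ (s :* m :+ s :* m) :+ ((s :+ m) :* m :+ (s :+ m) :* m)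
           := (s :+ m) :* (s :+ m) :+ (s :* m :+ (s :+ m) :* m)) refl s m ⟩
    (s + m) * (s + m) + (s * m + (s + m) * m)
      ≈⟨ +-congʳ (*-cong s+m≈a s+m≈a) ⟩
    a * a + (s * m + (s + m) * m)  ∎))
    where
    s : Carrier
    s = a - m

    s+m≈a : s + m ≈ a
    s+m≈a = //-rightDividesˡ m a

  -- Here `z` is y - 1, given by an additive equation so that polynomial identities in `x` and `z`
  -- stay free of negation.
  module _ (x y z : Carrier) (z+1≈y : z + 1# ≈ y) where

    -- The term x²zF² is xzF times xF. Replacing that xF by `D + x` makes x(F + zD)F = xAF appear,
    -- which together with the summand 1 is `F`.
    quadratic : ∀ {F A D} → F ≈ 1# + x * (A * F) → D ≈ x * (A * (D + x)) → A ≈ F + z * D →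
                x * (1# + x * z) * (F * F) + 1# ≈ (1# + x ^ 2 * z) * F
    quadratic {F} {A} {D} F-eq D-eq A-eq = ∙-cancelʳ (x * F) _ _ (begin
      x * (1# + x * z) * (F * F) + 1# + x * F
        ≈⟨ solve 3 (λ x z F →
             (x :* (con 1 :+ x :* z) :* (F :* F) :+ con 1) :+ x :* F
             := (con 1 :+ x :* (F :* F)) :+ x :* F :+ x :* z :* F :* (x :* F)) refl x z F ⟩
      1# + x * (F * F) + x * F + x * z * F * (x * F)
        ≈⟨ +-congˡ (*-congˡ T≈xF) ⟨
      1# + x * (F * F) + x * F + x * z * F * (D + x)
        ≈⟨ solve 4 (λ x z F D →
             (con 1 :+ x :* (F :* F)) :+ x :* F :+ x :* z :* F :* (D :+ x)
             := (con 1 :+ x :* ((F :+ z :* D) :* F)) :+ (x :* F :+ x :* x :* z :* F)) refl x z F D ⟩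
      1# + x * ((F + z * D) * F) + (x * F + x * x * z * F)
        ≈⟨ +-congʳ (+-congˡ (*-congˡ (*-congʳ A-eq))) ⟨
      1# + x * (A * F) + (x * F + x * x * z * F)
        ≈⟨ +-congʳ F-eq ⟨
      F + (x * F + x * x * z * F)
        ≈⟨ solve 3 (λ x z F → F :+ (x :* F :+ x :* x :* z :* F)
             := (con 1 :+ x :* (x :* con 1) :* z) :* F :+ x :* F) refl x z F ⟩
      (1# + x ^ 2 * z) * F + x * F  ∎)
      where
      -- D + x and x F both solve T = x + x A T, and F is the inverse of 1 - x A.
      T≈xF : D + x ≈ x * F
      T≈xF = ∙-cancelʳ (x * (A * F) * (D + x)) _ _ (begin
        D + x + x * (A * F) * (D + x)
          ≈⟨ solve 4 (λ x A F T → T :+ x :* (A :* F) :* T := (con 1 :+ x :* (A :* F)) :* T)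
               refl x A F (D + x) ⟩
        (1# + x * (A * F)) * (D + x)
          ≈⟨ *-congʳ F-eq ⟨
        F * (D + x)
          ≈⟨ *-congˡ (+-congʳ D-eq) ⟩
        F * (x * (A * (D + x)) + x)
          ≈⟨ solve 4 (λ x A F T → F :* (x :* (A :* T) :+ x) := x :* F :+ x :* (A :* F) :* T)
               refl x A F (D + x) ⟩
        x * F + x * (A * F) * (D + x)  ∎)

    denominator : 1# + x * y - x ≈ 1# + x * z
    denominator = sym (x≈z//y _ _ _ (begin
      1# + x * z + x     ≈⟨ solve 2 (λ x z → con 1 :+ x :* z :+ x := con 1 :+ x :* (z :+ con 1)) refl x z ⟩
      1# + x * (z + 1#)  ≈⟨ +-congˡ (*-congˡ z+1≈y) ⟩
      1# + x * y         ∎))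

    linear-coefficient : 1# - x ^ 2 + x ^ 2 * y ≈ 1# + x ^ 2 * z
    linear-coefficient = begin
      1# - x ^ 2 + x ^ 2 * y
        ≈⟨ +-congˡ (*-congˡ z+1≈y) ⟨
      1# - x ^ 2 + x ^ 2 * (z + 1#)
        ≈⟨ solve 3 (λ m p z → m :+ p :* (z :+ con 1) := (m :+ p) :+ p :* z) refl (1# - x ^ 2) (x ^ 2) z ⟩
      1# - x ^ 2 + x ^ 2 + x ^ 2 * z
        ≈⟨ +-congʳ (//-rightDividesˡ (x ^ 2) 1#) ⟩
      1# + x ^ 2 * z  ∎

    discriminant : 1# + 2 · x ^ 2 - 2 · x ^ 2 * y + x ^ 4 - 2 · x ^ 4 * y + x ^ 4 * y ^ 2 - 4 · x
                   ≈ (1# + x ^ 2 * z) * (1# + x ^ 2 * z) - 4 · (x * (1# + x * z))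
    discriminant = x≈z//y _ _ _ (∙-cancelʳ (n₁ + n₂ + n₃) _ _ (begin
      -- `C` has been moved over from the right, and the three subtracted terms have been added to
      -- both sides. The solver treats each of `n₁`, `n₂`, `n₃` and its negative as unrelated atoms.
      1# + 2 · x ^ 2 - n₁ + x ^ 4 - n₂ + r y - n₃ + C + (n₁ + n₂ + n₃)
        ≈⟨ solve 10 (λ p m₁ n₁ q m₂ n₂ r m₃ n₃ C →
             p :+ m₁ :+ q :+ m₂ :+ r :+ m₃ :+ C :+ (n₁ :+ n₂ :+ n₃)
             := (m₁ :+ n₁) :+ (m₂ :+ n₂) :+ (m₃ :+ n₃) :+ (p :+ q :+ r :+ C))
             refl (1# + 2 · x ^ 2) (- n₁) n₁ (x ^ 4) (- n₂) n₂ (r y) (- n₃) n₃ C ⟩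
      (- n₁ + n₁) + (- n₂ + n₂) + (- n₃ + n₃) + (1# + 2 · x ^ 2 + x ^ 4 + r y + C)
        ≈⟨ +-congʳ (+-cong (+-cong (-‿inverseˡ n₁) (-‿inverseˡ n₂)) (-‿inverseˡ n₃)) ⟩
      0# + 0# + 0# + (1# + 2 · x ^ 2 + x ^ 4 + r y + C)
        ≈⟨ +-congˡ (+-congʳ (+-congˡ (*-congˡ (*-cong z+1≈y (*-congʳ z+1≈y))))) ⟨
      0# + 0# + 0# + (1# + 2 · x ^ 2 + x ^ 4 + r (z + 1#) + C)
        ≈⟨ solve 2 (λ x z →
             con 0 :+ con 0 :+ con 0
             :+ (con 1 :+ twice (x :^ 2) :+ x :^ 4 :+ x :^ 4 :* (z :+ con 1) :^ 2
                 :+ twice² (x :* (con 1 :+ x :* z)))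
             := (con 1 :+ x :^ 2 :* z) :* (con 1 :+ x :^ 2 :* z)
                :+ (twice (x :^ 2) :* (z :+ con 1) :+ twice (x :^ 4) :* (z :+ con 1) :+ twice² x))
             refl x z ⟩
      B * B + (2 · x ^ 2 * (z + 1#) + 2 · x ^ 4 * (z + 1#) + n₃)
        ≈⟨ +-congˡ (+-congʳ (+-cong (*-congˡ z+1≈y) (*-congˡ z+1≈y))) ⟩
      B * B + (n₁ + n₂ + n₃)  ∎))
      where
      B C n₁ n₂ n₃ : Carrier
      B = 1# + x ^ 2 * z
      C = 4 · (x * (1# + x * z))
      n₁ = 2 · x ^ 2 * y
      n₂ = 2 · x ^ 4 * y
      n₃ = 4 · x

      r : Carrier → Carrier
      r y = x ^ 4 * y ^ 2

      -- These mirror how `2 ·` and `4 ·` unfold, including the final summand 0.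
      twice twice² : ∀ {n} → Expression n → Expression n
      twice  p = p :+ (p :+ con 0)
      twice² p = p :+ (p :+ (p :+ (p :+ con 0)))

    -- Completing the square: if aF² + 1 = bF, then (b - 2aF)² = b² - 4a, because (2aF)² + 4a =
    -- 4a(aF² + 1) = 2b(2aF).
    √discriminant : ∀ {F} → x * (1# + x * z) * (F * F) + 1# ≈ (1# + x ^ 2 * z) * F →
      √Δ x y F * √Δ x y F ≈
      1# + 2 · x ^ 2 - 2 · x ^ 2 * y + x ^ 4 - 2 · x ^ 4 * y + x ^ 4 * y ^ 2 - 4 · x
    √discriminant {F} quadratic-eq = begin
      s * s              ≈⟨ *-cong s≈ s≈ ⟩
      (B - M) * (B - M)  ≈⟨ square-of-difference (begin
        M * M + 4 · C
          ≈⟨ solve 3 (λ x z F → let c = con 1 :+ x :* z; m = (x :+ (x :+ con 0)) :* c :* F; C = x :* c in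
               m :* m :+ (C :+ (C :+ (C :+ (C :+ con 0))))
               := con 4 :* (C :* (C :* (F :* F) :+ con 1))) refl x z F ⟩
        k * (C * (C * (F * F) + 1#))
          ≈⟨ *-congˡ (*-congˡ quadratic-eq) ⟩
        k * (C * (B * F))
          ≈⟨ solve 4 (λ x z F B → let c = con 1 :+ x :* z; m = (x :+ (x :+ con 0)) :* c :* F; C = x :* c in
               con 4 :* (C :* (B :* F)) := B :* m :+ B :* m) refl x z F B ⟩
        B * M + B * M  ∎) ⟩
      B * B - 4 · C      ≈⟨ discriminant ⟨
      1# + 2 · x ^ 2 - 2 · x ^ 2 * y + x ^ 4 - 2 · x ^ 4 * y + x ^ 4 * y ^ 2 - 4 · x  ∎
      where
      B C M k s : Carrier
      B = 1# + x ^ 2 * z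
      C = x * (1# + x * z)
      M = 2 · x * (1# + x * z) * F
      -- Written as the element that `con 4` denotes in the solver.
      k = 1# + 1# + 1# + 1#
      s = √Δ x y F

      s≈ : s ≈ B - M
      s≈ = +-cong linear-coefficient (-‿cong (*-congʳ (*-congˡ denominator)))

    -- Singles out the correct branch of the square root: everything beyond 1 carries a factor `x`,
    -- so the constant term is 1.
    s≈1+x* : ∀ F → √Δ x y F ≈ 1# + x * (x * z - (1# + 1#) * ((1# + x * z) * F))
    s≈1+x* F = sym (x≈z//y _ _ _ (begin
      1# + x * (u - v) + 2 · x * (1# + x * y - x) * F
        ≈⟨ +-congˡ (*-congʳ (*-congˡ denominator)) ⟩
      1# + x * (u - v) + 2 · x * (1# + x * z) * F
        ≈⟨ solve 4 (λ x z F d → con 1 :+ x :* d :+ (x :+ (x :+ con 0)) :* (con 1 :+ x :* z) :* F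
             := con 1 :+ x :* (d :+ con 2 :* ((con 1 :+ x :* z) :* F))) refl x z F (u - v) ⟩
      1# + x * (u - v + v)
        ≈⟨ +-congˡ (*-congˡ (//-rightDividesˡ v u)) ⟩
      1# + x * (x * z)
        ≈⟨ solve 2 (λ x z → con 1 :+ x :* (x :* z) := con 1 :+ x :^ 2 :* z) refl x z ⟩
      1# + x ^ 2 * z
        ≈⟨ linear-coefficient ⟨
      1# - x ^ 2 + x ^ 2 * y  ∎))
      where
      u v : Carrier
      u = x * z
      v = (1# + 1#) * ((1# + x * z) * F)

    -- `F` is the series for which the functional equations are derived, `G` the one named in the
    -- statement; the two meet only in the quotient relation.
    solution : ∀ {G F A D} → G ≈ F → F ≈ 1# + x * (A * F) → D ≈ x * (A * (D + x)) → A ≈ F + z * D →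
               IsSolution _≈_ _+_ _*_ _-_ _^_ _·_ 1# x y G (√Δ x y F)
    solution {F = F} G≈F F-eq D-eq A-eq = record
      { square        = √discriminant (quadratic F-eq D-eq A-eq)
      ; constant-term = _ , s≈1+x* F
      ; quotient      = trans (*-congˡ G≈F) (b≈a-[a-b] _ _)
      }

-- Weighted sums over lists.

module WeightedSum {c ℓ} (R : CommutativeRing c ℓ) where
  open CommutativeRing R hiding (zero)
  open Sum semiring using (sum)
  open CommutativeSemigroupProperties +-commutativeSemigroup using (x∙yz≈y∙xz; interchange)
  open ≈-Reasoning setoid

  wsum : ∀ {a} {A : Set a} → (A → Carrier) → List A → Carrier
  wsum g []       = 0#
  wsum g (a ∷ as) = g a + wsum g as

  module _ {a} {A : Set a} where
    private
      variable
        g h : A → Carrier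
        xs ys : List A

    wsum-cong : (∀ {a} → a ∈ xs → g a ≈ h a) → wsum g xs ≈ wsum h xs
    wsum-cong {[]}     g≈h = refl
    wsum-cong {x ∷ xs} g≈h = +-cong (g≈h (here ≡.refl)) (wsum-cong (g≈h ∘ there))

    wsum-0 : (∀ {a} → a ∈ xs → g a ≈ 0#) → wsum g xs ≈ 0#
    wsum-0 {[]}     g≈0 = refl
    wsum-0 {x ∷ xs} g≈0 = trans (+-cong (g≈0 (here ≡.refl)) (wsum-0 (g≈0 ∘ there))) (+-identityʳ 0#)

    wsum-++ : ∀ xs → wsum g (xs ++ ys) ≈ wsum g xs + wsum g ys
    wsum-++ []       = sym (+-identityˡ _)
    wsum-++ (x ∷ xs) = trans (+-congˡ (wsum-++ xs)) (sym (+-assoc _ _ _))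

    wsum-↭ : xs ↭ ys → wsum g xs ≈ wsum g ys
    wsum-↭ ↭.refl                = refl
    wsum-↭ (prep x xs↭ys)        = +-congˡ (wsum-↭ xs↭ys)
    wsum-↭ (swap x y xs↭ys)      = trans (x∙yz≈y∙xz _ _ _) (+-congˡ (+-congˡ (wsum-↭ xs↭ys)))
    wsum-↭ (↭.trans xs↭ys ys↭zs) = trans (wsum-↭ xs↭ys) (wsum-↭ ys↭zs)

    wsum-+ : ∀ xs → wsum (λ a → g a + h a) xs ≈ wsum g xs + wsum h xs
    wsum-+ []       = sym (+-identityʳ 0#)
    wsum-+ (x ∷ xs) = trans (+-congˡ (wsum-+ xs)) (interchange _ _ _ _)

    wsum-*ˡ : ∀ u xs → wsum (λ a → u * g a) xs ≈ u * wsum g xs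
    wsum-*ˡ u []       = sym (zeroʳ u)
    wsum-*ˡ u (x ∷ xs) = trans (+-congˡ (wsum-*ˡ u xs)) (sym (distribˡ u _ _))

    -- With `wsum-cartesianProduct`, this makes the sum over all splittings, grouped by the size of
    -- the left part, a coefficient of a Cauchy product.
    wsum-concat-tabulate : ∀ {n} (xss : Fin n → List A) →
                           wsum g (concat (tabulate xss)) ≈ sum (λ i → wsum g (xss i))
    wsum-concat-tabulate {n = zero}  xss = refl
    wsum-concat-tabulate {n = suc n} xss =
      trans (wsum-++ (xss zero)) (+-congˡ (wsum-concat-tabulate (xss ∘ suc)))

  wsum-map : ∀ {a b} {A : Set a} {B : Set b} {g : B → Carrier} (f : A → B) xs →
             wsum g (map f xs) ≈ wsum (g ∘ f) xs
  wsum-map f []       = refl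
  wsum-map f (x ∷ xs) = +-congˡ (wsum-map f xs)

  module _ {a b} {A : Set a} {B : Set b} where
    wsum-cartesianProduct : ∀ {g : A → Carrier} {h : B → Carrier} xs ys →
      wsum (λ (a , b) → g a * h b) (cartesianProduct xs ys) ≈ wsum g xs * wsum h ys
    wsum-cartesianProduct []       ys = sym (zeroˡ _)
    wsum-cartesianProduct {g} {h} (x ∷ xs) ys = begin
      wsum gh (map (x ,_) ys ++ cartesianProduct xs ys)
        ≈⟨ wsum-++ (map (x ,_) ys) ⟩
      wsum gh (map (x ,_) ys) + wsum gh (cartesianProduct xs ys)
        ≈⟨ +-cong (trans (wsum-map (x ,_) ys) (wsum-*ˡ (g x) ys)) (wsum-cartesianProduct xs ys) ⟩
      g x * wsum h ys + wsum g xs * wsum h ys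
        ≈⟨ distribʳ _ _ _ ⟨
      wsum g (x ∷ xs) * wsum h ys  ∎
      where
      gh : _ → Carrier
      gh (a , b) = g a * h b

-- Words of natural numbers and their statistics.

module Permutations where
  open import Data.Nat.Base using (_+_)
  open ≡ using (refl; sym; trans)

  private
    variable
      a b p q ℓ : Level
      A : Set a
      B : Set b
      k l m n : ℕ

  indicator : Dec A → ℕ
  indicator a? = if does a? then 1 else 0

  indicator-⇔ : A ⇔ B → (a? : Dec A) (b? : Dec B) → indicator a? ≡ indicator b?
  indicator-⇔ A⇔B a? b? = cong (if_then 1 else 0) (does-⇔ A⇔B a? b?)

  indicator-true : (a? : Dec A) → A → indicator a? ≡ 1
  indicator-true a? x = cong (if_then 1 else 0) (dec-true a? x)

  indicator-false : (a? : Dec A) → ¬ A → indicator a? ≡ 0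
  indicator-false a? ¬x = cong (if_then 1 else 0) (dec-false a? ¬x)

  occ213 : List ℕ → ℕ
  occ213 (a ∷ w@(b ∷ c ∷ _)) = indicator ((b <? a) ×-dec (a <? c)) + occ213 w
  occ213 _                   = 0

  -- Valued in 0 and 1, so that it can be added to `occ213` and used as a multiplicity.
  finalDescent : List ℕ → ℕ
  finalDescent (a ∷ b ∷ [])        = indicator (b <? a)
  finalDescent (a ∷ w@(b ∷ c ∷ _)) = finalDescent w
  finalDescent _                   = 0

  isSingleton : List ℕ → ℕ
  isSingleton (_ ∷ []) = 1
  isSingleton _        = 0

  -- The head `a` plays the 1 of the pattern, a later pair `b`, `c` the 3 and the 2.
  Avoids132 : List ℕ → Set
  Avoids132 []      = ⊤
  Avoids132 (a ∷ w) = AllPairs (λ b c → ¬ (a < c × c < b)) w × Avoids132 w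

  finalDescent-0∨1 : ∀ w → finalDescent w ≡ 0 ⊎ finalDescent w ≡ 1
  finalDescent-0∨1 []                  = inj₁ refl
  finalDescent-0∨1 (_ ∷ [])            = inj₁ refl
  finalDescent-0∨1 (a ∷ b ∷ [])        with does (b <? a)
  ... | true  = inj₂ refl
  ... | false = inj₁ refl
  finalDescent-0∨1 (_ ∷ w@(_ ∷ _ ∷ _)) = finalDescent-0∨1 w

  occ213-shift : ∀ k w → occ213 (map (k +_) w) ≡ occ213 w
  occ213-shift k []              = refl
  occ213-shift k (a ∷ [])        = refl
  occ213-shift k (a ∷ b ∷ [])    = refl
  occ213-shift k (a ∷ w@(b ∷ c ∷ _)) = cong₂ _+_
    (indicator-⇔ (mk⇔ (λ (p , q) → ℕ.+-cancelˡ-< k b a p , ℕ.+-cancelˡ-< k a c q)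
                      (λ (p , q) → ℕ.+-monoʳ-< k p , ℕ.+-monoʳ-< k q))
                 ((k + b <? k + a) ×-dec (k + a <? k + c)) ((b <? a) ×-dec (a <? c)))
    (occ213-shift k w)

  finalDescent-shift : ∀ k w → finalDescent (map (k +_) w) ≡ finalDescent w
  finalDescent-shift k []                  = refl
  finalDescent-shift k (a ∷ [])            = refl
  finalDescent-shift k (a ∷ b ∷ [])        =
    indicator-⇔ (mk⇔ (ℕ.+-cancelˡ-< k b a) (ℕ.+-monoʳ-< k)) (k + b <? k + a) (b <? a)
  finalDescent-shift k (a ∷ w@(b ∷ c ∷ _)) = finalDescent-shift k w

  occ213-max∷ : ∀ {R} → All (_< m) R → occ213 (m ∷ R) ≡ occ213 R
  occ213-max∷ []           = refl
  occ213-max∷ (_ ∷ [])     = refl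
  occ213-max∷ {m} {b ∷ c ∷ R} (_ ∷ c<m ∷ _) = cong (_+ occ213 (b ∷ c ∷ R))
    (indicator-false ((b <? m) ×-dec (m <? c)) (ℕ.<-asym c<m ∘ proj₂))

  -- In a window of three letters containing `m`, only `m` can play the 3, so the window must end in
  -- `m`. It is then an occurrence exactly when `L` ends in a descent. The induction reaches such
  -- windows when at most two letters of `L` remain.
  occ213-max : ∀ {L R} → All (_< m) L → All (_< m) R →
               occ213 (L ++ m ∷ R) ≡ occ213 L + finalDescent L + occ213 R
  occ213-max {L = []} [] R<m = occ213-max∷ R<m
  occ213-max {L = a ∷ []} {[]}        (a<m ∷ []) R<m = refl
  occ213-max {m} {a ∷ []} {R@(c ∷ _)} (a<m ∷ []) R<m = cong₂ _+_
    (indicator-false ((m <? a) ×-dec (a <? c)) (ℕ.<-asym a<m ∘ proj₁)) (occ213-max∷ R<m)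
  occ213-max {m} {a ∷ b ∷ []} {R} (a<m ∷ b<m ∷ []) R<m = cong₂ _+_
    (indicator-⇔ (mk⇔ proj₁ (_, a<m)) ((b <? a) ×-dec (a <? m)) (b <? a))
    (occ213-max (b<m ∷ []) R<m)
  occ213-max {m} {a ∷ L@(b ∷ c ∷ _)} {R} (_ ∷ L<m) R<m = begin
    i + occ213 (L ++ m ∷ R)                      ≡⟨ cong (i +_) (occ213-max L<m R<m) ⟩
    i + (occ213 L + finalDescent L + occ213 R)   ≡⟨ ℕ.+-assoc i _ (occ213 R) ⟨
    i + (occ213 L + finalDescent L) + occ213 R   ≡⟨ cong (_+ occ213 R) (ℕ.+-assoc i (occ213 L) _) ⟨
    i + occ213 L + finalDescent L + occ213 R     ∎
    where
    open ≡-Reasoning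
    i = indicator ((b <? a) ×-dec (a <? c))

  -- With two or more letters in `R` the last pair lies in `R`; with one letter it is `m` followed
  -- by that letter, a descent; with none the word ends in its maximum and has no final descent.
  finalDescent-max : ∀ {L R} → All (_< m) L → All (_< m) R →
                     finalDescent (L ++ m ∷ R) ≡ finalDescent R + isSingleton R
  finalDescent-max {L = []} [] []                     = refl
  finalDescent-max {m} {[]} {r ∷ []} [] (r<m ∷ [])    = indicator-true (r <? m) r<m
  finalDescent-max {L = []} {R@(_ ∷ _ ∷ _)} [] R<m    = sym (ℕ.+-identityʳ (finalDescent R))
  finalDescent-max {m} {a ∷ []} {[]} (a<m ∷ []) []    = indicator-false (m <? a) (ℕ.<-asym a<m)
  finalDescent-max {L = a ∷ []} {_ ∷ _} (_ ∷ []) R<m  = finalDescent-max [] R<m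
  finalDescent-max {L = _ ∷ _ ∷ []}    (_ ∷ L<m) R<m  = finalDescent-max L<m R<m
  finalDescent-max {L = _ ∷ _ ∷ _ ∷ _} (_ ∷ L<m) R<m  = finalDescent-max L<m R<m

  -- Distinct letters, shifts and 1-3-2-avoidance.

  AllPairs-++⁻ : ∀ {R : Rel A ℓ} xs {ys} → AllPairs R (xs ++ ys) →
                 AllPairs R xs × AllPairs R ys × All (λ x → All (R x) ys) xs
  AllPairs-++⁻ []       Rys         = [] , Rys , []
  AllPairs-++⁻ (x ∷ xs) (Rx ∷ Rxsys) =
    let Rxs , Rys , Rxs,ys = AllPairs-++⁻ xs Rxsys
    in All.++⁻ˡ xs Rx ∷ Rxs , Rys , All.++⁻ʳ xs Rx ∷ Rxs,ys

  AllPairs-lookup : ∀ {R : Rel A ℓ} {xs} → AllPairs R xs → ∀ {i j} → i Fin.< j →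
                    R (List.lookup xs i) (List.lookup xs j)
  AllPairs-lookup {xs = _ ∷ xs} (Rx ∷ _) {zero}  {suc j} _         = All.lookup Rx (∈-lookup {xs = xs} j)
  AllPairs-lookup (_ ∷ Rxs)              {suc i} {suc j} (s<s i<j) = AllPairs-lookup Rxs i<j

  unique-length : ∀ {w} → All (_< m) w → Unique w → length w ≤ m
  unique-length {m} {w} w<m w! = ℕ.≮⇒≥ λ m<∣w∣ →
    let i , j , i<j , eq = Fin.pigeonhole m<∣w∣ (λ i → fromℕ< (lookup<m i))
    in AllPairs-lookup w! i<j (Fin.fromℕ<-injective _ _ (lookup<m i) (lookup<m j) eq)
    where
    lookup<m : ∀ i → List.lookup w i < m
    lookup<m i = All.lookup w<m (∈-lookup {xs = w} i)

  unshift : ∀ k {w} → All (k ≤_) w → ∃ λ v → w ≡ map (k +_) v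
  unshift k []          = [] , refl
  unshift k (k≤a ∷ k≤w) with v , refl ← unshift k k≤w =
    _ ∷ v , cong (_∷ map (k +_) v) (sym (ℕ.m+[n∸m]≡n k≤a))

  Avoids132-shift⁺ : ∀ k w → Avoids132 w → Avoids132 (map (k +_) w)
  Avoids132-shift⁺ k []      _           = tt
  Avoids132-shift⁺ k (a ∷ w) (aw , avoids) =
    AllPairs.map⁺ (AllPairs.map (λ ¬acb (p , q) →
      ¬acb (ℕ.+-cancelˡ-< k _ _ p , ℕ.+-cancelˡ-< k _ _ q)) aw) ,
    Avoids132-shift⁺ k w avoids

  Avoids132-shift⁻ : ∀ k w → Avoids132 (map (k +_) w) → Avoids132 w
  Avoids132-shift⁻ k []      _           = tt
  Avoids132-shift⁻ k (a ∷ w) (aw , avoids) =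
    AllPairs.map (λ ¬acb (p , q) → ¬acb (ℕ.+-monoʳ-< k p , ℕ.+-monoʳ-< k q)) (AllPairs.map⁻ aw) ,
    Avoids132-shift⁻ k w avoids

  AllPairs-from-All : ∀ {P : Pred A p} {R : Rel A ℓ} → (∀ {x y} → P y → R x y) →
                      ∀ {xs} → All P xs → AllPairs R xs
  AllPairs-from-All P⇒R []         = []
  AllPairs-from-All P⇒R (_ ∷ Pxs) = All.map P⇒R Pxs ∷ AllPairs-from-All P⇒R Pxs

  -- A letter `a` of `L` cannot be the 1 of a pattern whose 2 lies in `R`, as `R` is below `a`, nor
  -- of one whose 2 is `m`, as nothing exceeds `m`. Nor can `m` itself be the 1.
  Avoids132-max⁺ : ∀ {L R} → All (_< m) L → All (_< m) R → All (λ a → All (_< a) R) L →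
                   Avoids132 L → Avoids132 R → Avoids132 (L ++ m ∷ R)
  Avoids132-max⁺ [] R<m [] _ R-avoids =
    AllPairs-from-All (λ c<m (m<c , _) → ℕ.<-asym c<m m<c) R<m , R-avoids
  Avoids132-max⁺ {R = R} (_ ∷ L<m) R<m (R<a ∷ R<L) (aL , L-avoids) R-avoids =
    AllPairs.++⁺ aL
      (All.map below R<a ∷ AllPairs-from-All below R<a)
      (All.map (λ b<m → (λ (_ , m<b) → ℕ.<-asym b<m m<b) ∷ All.map below R<a) L<m) ,
    Avoids132-max⁺ L<m R<m R<L L-avoids R-avoids
    where
    below : ∀ {a b c} → c < a → ¬ (a < c × c < b)
    below c<a (a<c , _) = ℕ.<-asym c<a a<c

  Avoids132-++⁻ : ∀ L {w} → Avoids132 (L ++ w) → Avoids132 L × Avoids132 w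
  Avoids132-++⁻ []      avoids        = tt , avoids
  Avoids132-++⁻ (a ∷ L) (aLw , avoids) =
    let L-avoids , w-avoids = Avoids132-++⁻ L avoids
    in (proj₁ (AllPairs-++⁻ L aLw) , L-avoids) , w-avoids

  -- If `a` in `L` were less than `c` in `R`, then `a`, `m`, `c` would form 1-3-2. The inequality
  -- becomes strict only once letters are known to be distinct.
  Avoids132-max⁻ : ∀ L {R} → All (_< m) R → Avoids132 (L ++ m ∷ R) →
                   All (λ a → All (_≤ a) R) L
  Avoids132-max⁻ []      R<m _              = []
  Avoids132-max⁻ (a ∷ L) R<m (aLmR , avoids) with _ , (amR ∷ _) , _ ← AllPairs-++⁻ L aLmR =
    All.zipWith (λ (c<m , ¬amc) → ℕ.≮⇒≥ (λ a<c → ¬amc (a<c , c<m))) (R<m , amR)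
    ∷ Avoids132-max⁻ L R<m avoids

  -- The decomposition of an avoider at its maximum.

  record Avoider (n : ℕ) (w : List ℕ) : Set where
    constructor avoider
    field
      length≡ : length w ≡ n
      bounded : All (_< n) w
      unique  : Unique w
      avoids  : Avoids132 w

  length-join : ∀ k L {m R} → length (map (k +_) L ++ m ∷ R) ≡ suc (length R + length L)
  length-join k L {R = R} = begin
    length (map (k +_) L ++ _ ∷ R)          ≡⟨ List.length-++ (map (k +_) L) ⟩
    length (map (k +_) L) + suc (length R)  ≡⟨ ℕ.+-comm _ (suc (length R)) ⟩
    suc (length R + length (map (k +_) L))  ≡⟨ cong (λ i → suc (length R + i)) (List.length-map (k +_) L) ⟩
    suc (length R + length L)               ∎
    where open ≡-Reasoning

  -- The word L m R of the decomposition, for standardised parts: `R` keeps its letters, `L` is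
  -- raised above them, and the maximum is the total size.
  glue : List ℕ → List ℕ → List ℕ
  glue L R = map (length R +_) L ++ (length R + length L) ∷ R

  module _ {k l L R} (L-avoider : Avoider k L) (R-avoider : Avoider l R) where
    private
      module L = Avoider L-avoider
      module R = Avoider R-avoider

    glue-max : length R + length L ≡ k + l
    glue-max = trans (cong₂ _+_ R.length≡ L.length≡) (ℕ.+-comm l k)

    shifted-bounded : All (_< length R + length L) (map (length R +_) L)
    shifted-bounded rewrite L.length≡ = All.map⁺ (All.map (ℕ.+-monoʳ-< (length R)) L.bounded)

    lower-bounded : All (_< length R + length L) R
    lower-bounded rewrite R.length≡ = All.map (λ r<l → ℕ.<-≤-trans r<l (ℕ.m≤m+n l (length L))) R.bounded

    lower<shifted : All (λ a → All (_< a) R) (map (length R +_) L)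
    lower<shifted rewrite R.length≡ =
      All.map⁺ (All.universal (λ a → All.map (λ r<l → ℕ.<-≤-trans r<l (ℕ.m≤m+n l a)) R.bounded) L)

    glue-occ213 : occ213 (glue L R) ≡ occ213 L + finalDescent L + occ213 R
    glue-occ213 = trans (occ213-max shifted-bounded lower-bounded)
      (cong (_+ occ213 R) (cong₂ _+_ (occ213-shift (length R) L) (finalDescent-shift (length R) L)))

    glue-finalDescent : finalDescent (glue L R) ≡ finalDescent R + isSingleton R
    glue-finalDescent = finalDescent-max shifted-bounded lower-bounded

    glue-avoider : Avoider (suc (k + l)) (glue L R)
    glue-avoider = avoider
      (trans (length-join (length R) L) (cong suc glue-max))
      (subst (λ s → All (_< suc s) (glue L R)) glue-max
        (All.++⁺ (All.map ℕ.m<n⇒m<1+n shifted-bounded)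
                 (ℕ.n<1+n _ ∷ All.map ℕ.m<n⇒m<1+n lower-bounded)))
      (AllPairs.++⁺ (Unique.map⁺ (ℕ.+-cancelˡ-≡ (length R) _ _) L.unique)
                    (All.map (λ r<m m≡r → ℕ.<⇒≢ r<m (sym m≡r)) lower-bounded ∷ R.unique)
                    (All.zipWith (λ (a<m , R<a) → ℕ.<⇒≢ a<m ∷ All.map (λ r<a a≡r → ℕ.<⇒≢ r<a (sym a≡r)) R<a)
                                 (shifted-bounded , lower<shifted)))
      (Avoids132-max⁺ shifted-bounded lower-bounded lower<shifted
                      (Avoids132-shift⁺ (length R) L L.avoids) R.avoids)

  -- Both prefixes lack `m`, so both sides are cut at the first occurrence of `m`.
  ++-∷-injective : ∀ {m : A} xs {xs′ ys ys′} → All (_≢ m) xs → All (_≢ m) xs′ →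
                   xs ++ m ∷ ys ≡ xs′ ++ m ∷ ys′ → xs ≡ xs′ × ys ≡ ys′
  ++-∷-injective []       {[]}      _          _          refl = refl , refl
  ++-∷-injective []       {_ ∷ _}   _          (m≢m ∷ _) refl = contradiction refl m≢m
  ++-∷-injective (_ ∷ _)  {[]}      (m≢m ∷ _) _          refl = contradiction refl m≢m
  ++-∷-injective (x ∷ xs) {_ ∷ xs′} (_ ∷ xs≢) (_ ∷ xs′≢) eq
    with refl , eq′ ← List.∷-injective eq
    with refl , ys≡ ← ++-∷-injective xs xs≢ xs′≢ eq′ = refl , ys≡

  -- Equal total sizes give equal maxima, so both words are cut at the same letter; `R` then
  -- determines the shift to be removed from the left part.
  glue-injective : ∀ {k l k′ l′ L R L′ R′} → k + l ≡ k′ + l′ →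
    Avoider k L → Avoider l R → Avoider k′ L′ → Avoider l′ R′ →
    glue L R ≡ glue L′ R′ → L ≡ L′ × R ≡ R′
  glue-injective {L = L} {R} {L′} {R′} sum≡ aL aR aL′ aR′ eq
    with max≡ ← trans (glue-max aL aR) (trans sum≡ (sym (glue-max aL′ aR′)))
    with mapL≡ , refl ← ++-∷-injective (map (length R +_) L)
           (All.map ℕ.<⇒≢ (shifted-bounded aL aR))
           (subst (λ m → All (_≢ m) (map (length R′ +_) L′)) (sym max≡)
             (All.map ℕ.<⇒≢ (shifted-bounded aL′ aR′)))
           (trans eq (cong (λ m → map (length R′ +_) L′ ++ m ∷ R′) (sym max≡)))
    = List.map-injective (ℕ.+-cancelˡ-≡ (length R) _ _) mapL≡ , refl

  <∧≢⇒< : ∀ {w} → All (_< suc n) w → All (n ≢_) w → All (_< n) w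
  <∧≢⇒< w<1+n n∉w = All.zipWith (λ (a<1+n , n≢a) → ℕ.≤∧≢⇒< (s≤s⁻¹ a<1+n) (n≢a ∘ sym)) (w<1+n , n∉w)

  -- Pigeonhole: otherwise n + 1 distinct letters would all lie below `n`.
  max∈ : ∀ {w} → Avoider (suc n) w → n ∈ w
  max∈ {n} {w} (avoider length≡ bounded unique _) with Any.any? (n ≟_) w
  ... | yes n∈w = n∈w
  ... | no  n∉w = contradiction
    (unique-length (<∧≢⇒< bounded (All.¬Any⇒All¬ w n∉w)) unique)
    (ℕ.<⇒≱ (subst (n <_) (sym length≡) (ℕ.n<1+n n)))

  unique-length-between : ∀ {w} → k ≤ m → All (k ≤_) w → All (_< m) w → Unique w → k + length w ≤ m
  unique-length-between {k} k≤m k≤w w<m w!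
    with o , refl ← ℕ.m≤n⇒∃[o]m+o≡n k≤m
    with v , refl ← unshift k k≤w
    rewrite List.length-map (k +_) v =
    ℕ.+-monoʳ-≤ k (unique-length (All.map (ℕ.+-cancelˡ-< k _ _) (All.map⁻ w<m)) (Unique.map⁻ w!))

  -- The word is cut at its maximum `n`; avoidance puts the left part above the right one, and
  -- counting distinct letters shows that each part fills an interval of values.
  unglue : ∀ {w} → Avoider (suc n) w →
           ∃₂ λ L R → Avoider (length L) L × Avoider (length R) R × length L + length R ≡ n × w ≡ glue L R
  unglue {n} aw with L↑ , R , refl ← ∈-∃++ (max∈ aw)
    with avoider length≡ bounded unique avoids ← aw
    with L↑! , (n∉R ∷ R!) , L↑≢nR ← AllPairs-++⁻ L↑ unique
    with L↑-avoids , (_ , R-avoids) ← Avoids132-++⁻ L↑ avoids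
    with L↑<1+n , (_ ∷ R<1+n) ← All.++⁻ L↑ bounded
    with L↑<n ← <∧≢⇒< L↑<1+n (All.map (λ a≢nR n≡a → All.head a≢nR (sym n≡a)) L↑≢nR)
       | R<n ← <∧≢⇒< R<1+n n∉R
    with R<L↑ ← All.zipWith (λ (R≤a , a≢nR) →
                   All.zipWith (λ (r≤a , a≢r) → ℕ.≤∧≢⇒< r≤a (a≢r ∘ sym)) (R≤a , All.tail a≢nR))
                 (Avoids132-max⁻ L↑ R<n avoids , L↑≢nR)
    -- Each letter of the left part exceeds all the distinct letters of `R`, hence is at least
    -- `length R`.
    with L , refl ← unshift (length R) (All.map (λ R<a → unique-length R<a R!) R<L↑)
    with sum≡ ← ℕ.suc-injective (trans (sym (length-join (length R) L)) length≡)
    = L , R ,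
      avoider refl (All.map (λ {a} p → ℕ.+-cancelˡ-< (length R) a (length L) (subst (length R + a <_) (sym sum≡) p))
                            (All.map⁻ L↑<n))
              (Unique.map⁻ L↑!) (Avoids132-shift⁻ (length R) L L↑-avoids) ,
      -- All letters of the left part lie strictly between `r` and `n`, which is the sum of the two
      -- lengths, so `r` is less than `length R`.
      avoider refl (All.tabulate λ {r} r∈R → ℕ.+-cancelʳ-≤ (length L) (suc r) (length R)
                      (subst₂ (λ i j → suc r + i ≤ j) (List.length-map _ L) (sym sum≡)
                        (unique-length-between (All.lookup R<n r∈R)
                           (All.map (λ R<a → All.lookup R<a r∈R) R<L↑) L↑<n L↑!)))
              R! R-avoids ,
      trans (ℕ.+-comm (length L) (length R)) sum≡ ,
      cong (λ m → map (length R +_) L ++ m ∷ R) (sym sum≡)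

  -- Vectors over `Fin n` as words of natural numbers.

  length-filter-∷ : {P : Pred A p} (P? : Decidable P) {x : A} {xs : List A} →
                    length (filter P? (x ∷ xs)) ≡ indicator (P? x) + length (filter P? xs)
  length-filter-∷ P? {x} with does (P? x)
  ... | true  = refl
  ... | false = refl

  letters : Vec (Fin n) k → List ℕ
  letters []      = []
  letters (i ∷ v) = toℕ i ∷ letters v

  letters-length : (v : Vec (Fin n) k) → length (letters v) ≡ k
  letters-length []      = refl
  letters-length (i ∷ v) = cong suc (letters-length v)

  letters-injective : (v v′ : Vec (Fin n) k) → letters v ≡ letters v′ → v ≡ v′
  letters-injective []      []        _  = refl
  letters-injective (i ∷ v) (i′ ∷ v′) eq =
    let i≡ , v≡ = List.∷-injective eq
    in cong₂ _∷_ (Fin.toℕ-injective i≡) (letters-injective v v′ v≡)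

  letters-surjective : ∀ {w} → All (_< n) w → ∃ λ (v : Vec (Fin n) (length w)) → letters v ≡ w
  letters-surjective []          = [] , refl
  letters-surjective (a<n ∷ w<n) =
    let v , v≡w = letters-surjective w<n
    in fromℕ< a<n ∷ v , cong₂ _∷_ (Fin.toℕ-fromℕ< a<n) v≡w

  module _ {P : Pred ℕ p} where
    All-letters⁺ : (v : Vec (Fin n) k) → (∀ i → P (toℕ (lookup v i))) → All P (letters v)
    All-letters⁺ []      Pv = []
    All-letters⁺ (a ∷ v) Pv = Pv zero ∷ All-letters⁺ v (Pv ∘ suc)

    All-letters⁻ : (v : Vec (Fin n) k) → All P (letters v) → ∀ i → P (toℕ (lookup v i))
    All-letters⁻ (a ∷ v) (Pa ∷ Pv) zero    = Pa
    All-letters⁻ (a ∷ v) (Pa ∷ Pv) (suc i) = All-letters⁻ v Pv i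

  module _ {R : Rel ℕ ℓ} where
    AllPairs-letters⁺ : (v : Vec (Fin n) k) →
      (∀ {i j} → i Fin.< j → R (toℕ (lookup v i)) (toℕ (lookup v j))) → AllPairs R (letters v)
    AllPairs-letters⁺ []      Rv = []
    AllPairs-letters⁺ (a ∷ v) Rv = All-letters⁺ v (λ i → Rv z<s) ∷ AllPairs-letters⁺ v (Rv ∘ s<s)

    AllPairs-letters⁻ : (v : Vec (Fin n) k) → AllPairs R (letters v) →
      ∀ {i j} → i Fin.< j → R (toℕ (lookup v i)) (toℕ (lookup v j))
    AllPairs-letters⁻ (a ∷ v) (Ra ∷ Rv) {zero}  {suc j} _         = All-letters⁻ v Ra j
    AllPairs-letters⁻ (a ∷ v) (Ra ∷ Rv) {suc i} {suc j} (s<s i<j) = AllPairs-letters⁻ v Rv i<j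

  letters-unique⁺ : (v : Vec (Fin n) k) → Vec.Unique v → Unique (letters v)
  letters-unique⁺ []      []        = []
  letters-unique⁺ (a ∷ v) (a∉v ∷ v!) =
    All-letters⁺ v (λ i → VecAll.lookup⁺ a∉v i ∘ Fin.toℕ-injective) ∷ letters-unique⁺ v v!

  letters-unique⁻ : (v : Vec (Fin n) k) → Unique (letters v) → Vec.Unique v
  letters-unique⁻ []      []         = []
  letters-unique⁻ (a ∷ v) (a∉v ∷ v!) =
    VecAll.lookup⁻ (λ i → All-letters⁻ v a∉v i ∘ cong toℕ) ∷ letters-unique⁻ v v!

  -- The notion of the statement with the length `k` freed from the alphabet size `n`, so that
  -- induction can drop the first letter; `OccursAt` is generalised for the same reason.
  Contains : Vec (Fin n) k → Set
  Contains v = ∃[ a ] ∃[ b ] ∃[ c ]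
    (a Fin.< b × b Fin.< c × lookup v a Fin.< lookup v c × lookup v c Fin.< lookup v b)

  letters-avoids⁺ : (v : Vec (Fin n) k) → ¬ Contains v → Avoids132 (letters v)
  letters-avoids⁺ []      _      = tt
  letters-avoids⁺ (a ∷ v) avoids =
    AllPairs-letters⁺ v (λ i<j (p , q) → avoids (zero , suc _ , suc _ , z<s , s<s i<j , p , q)) ,
    letters-avoids⁺ v (λ (i , j , k , i<j , j<k , pq) →
      avoids (suc i , suc j , suc k , s<s i<j , s<s j<k , pq))

  letters-avoids⁻ : (v : Vec (Fin n) k) → Avoids132 (letters v) → ¬ Contains v
  letters-avoids⁻ (a ∷ v) (av , _)     (zero  , suc j , suc k , _       , s<s j<k , pq) =
    AllPairs-letters⁻ v av j<k pq
  letters-avoids⁻ (a ∷ v) (_ , avoids) (suc i , suc j , suc k , s<s i<j , s<s j<k , pq) =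
    letters-avoids⁻ v avoids (i , j , k , i<j , j<k , pq)

  OccursAt : Vec (Fin n) k → Fin k → Set
  OccursAt v i = ∃[ j ] ∃[ k ]
    (toℕ j ≡ suc (toℕ i) × toℕ k ≡ suc (toℕ j) ×
     lookup v j Fin.< lookup v i × lookup v i Fin.< lookup v k)

  occursAt? : (v : Vec (Fin n) k) → Decidable (OccursAt v)
  occursAt? v i = Fin.any? λ j → Fin.any? λ k →
    (toℕ j ≟ suc (toℕ i)) ×-dec (toℕ k ≟ suc (toℕ j)) ×-dec
    (lookup v j Fin.<? lookup v i) ×-dec (lookup v i Fin.<? lookup v k)

  length-filter-tabulate : {P : Pred A p} {Q : Pred B q} (P? : Decidable P) (Q? : Decidable Q)
    (f : Fin n → A) (g : Fin n → B) → (∀ i → P (f i) ⇔ Q (g i)) →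
    length (filter P? (tabulate f)) ≡ length (filter Q? (tabulate g))
  length-filter-tabulate {n = zero}  P? Q? f g P⇔Q = refl
  length-filter-tabulate {n = suc n} P? Q? f g P⇔Q = begin
    length (filter P? (tabulate f))
      ≡⟨ length-filter-∷ P? ⟩
    indicator (P? (f zero)) + length (filter P? (tabulate (f ∘ suc)))
      ≡⟨ cong₂ _+_ (indicator-⇔ (P⇔Q zero) (P? (f zero)) (Q? (g zero)))
                   (length-filter-tabulate P? Q? (f ∘ suc) (g ∘ suc) (P⇔Q ∘ suc)) ⟩
    indicator (Q? (g zero)) + length (filter Q? (tabulate (g ∘ suc)))
      ≡⟨ length-filter-∷ Q? ⟨
    length (filter Q? (tabulate g))  ∎
    where open ≡-Reasoning

  -- Occurrences after the first position are those of the tail moved by one, and `occ213-head`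
  -- compares the first window.
  occ213-letters : (v : Vec (Fin n) k) → length (filter (occursAt? v) (allFin k)) ≡ occ213 (letters v)
  occ213-letters []      = refl
  occ213-letters {k = suc k} (a ∷ v) = begin
    length (filter (occursAt? (a ∷ v)) (allFin (suc k)))
      ≡⟨ length-filter-∷ (occursAt? (a ∷ v)) ⟩
    indicator (occursAt? (a ∷ v) zero) + length (filter (occursAt? (a ∷ v)) (tabulate suc))
      ≡⟨ cong (indicator (occursAt? (a ∷ v) zero) +_)
           (trans (length-filter-tabulate (occursAt? (a ∷ v)) (occursAt? v) suc id (λ i → mk⇔ shift⁻ shift⁺))
                  (occ213-letters v)) ⟩
    indicator (occursAt? (a ∷ v) zero) + occ213 (letters v)
      ≡⟨ occ213-head v ⟩
    occ213 (letters (a ∷ v))  ∎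
    where
    open ≡-Reasoning

    shift⁺ : ∀ {i} → OccursAt v i → OccursAt (a ∷ v) (suc i)
    shift⁺ (j , k , j≡ , k≡ , pq) = suc j , suc k , cong suc j≡ , cong suc k≡ , pq

    shift⁻ : ∀ {i} → OccursAt (a ∷ v) (suc i) → OccursAt v i
    shift⁻ (suc j , suc k , j≡ , k≡ , pq) = j , k , ℕ.suc-injective j≡ , ℕ.suc-injective k≡ , pq

    occ213-head : ∀ v → indicator (occursAt? (a ∷ v) zero) + occ213 (letters v) ≡ occ213 (letters (a ∷ v))
    occ213-head []          = cong (_+ 0) (indicator-false (occursAt? (a ∷ []) zero)
      λ { (zero , _ , () , _) })
    occ213-head (b ∷ [])    = cong (_+ 0) (indicator-false (occursAt? (a ∷ b ∷ []) zero)
      λ { (suc zero , zero , _ , () , _) ; (suc zero , suc zero , _ , () , _) })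
    occ213-head (b ∷ c ∷ v) = cong (_+ occ213 (letters (b ∷ c ∷ v)))
      (indicator-⇔ (mk⇔ (λ { (suc zero , suc (suc zero) , refl , refl , pq) → pq })
                        (λ pq → suc zero , suc (suc zero) , refl , refl , pq))
                   (occursAt? (a ∷ b ∷ c ∷ v) zero) ((toℕ b <? toℕ a) ×-dec (toℕ a <? toℕ c)))

  -- Enumeration of avoiders and of their splittings.

  avoider? : (π : Vec (Fin n) n) → Dec (IsPermutation π × Avoids1-3-2 π)
  avoider? π = isPermutation? π ×-dec ¬? (contains1-3-2? π)

  words-complete : (v : Vec (Fin n) k) → v ∈ words n k
  words-complete []      = here refl
  words-complete (i ∷ v) = ∈-cartesianProductWith⁺ _∷_ (∈-allFin i) (words-complete v)

  words-unique : ∀ n k → Unique (words n k)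
  words-unique n zero    = [] ∷ []
  words-unique n (suc k) = Unique.cartesianProductWith⁺ _∷_ (λ { refl → refl , refl })
                             (Unique.allFin⁺ n) (words-unique n k)

  -- Opaque, since with-abstractions would otherwise normalise the enumeration.
  opaque
    avoiders : ℕ → List (List ℕ)
    avoiders n = map letters (filter avoider? (words n n))

    avoiders-0 : avoiders 0 ≡ [] ∷ []
    avoiders-0 = refl

    avoiders-1 : avoiders 1 ≡ (0 ∷ []) ∷ []
    avoiders-1 = refl

    avoiders-unique : ∀ n → Unique (avoiders n)
    avoiders-unique n = Unique.map⁺ (letters-injective _ _) (Unique.filter⁺ avoider? (words-unique n n))

    ∈-avoiders⁺ : ∀ {w} → Avoider n w → w ∈ avoiders n
    ∈-avoiders⁺ {n} {w} (avoider refl bounded unique avoids) =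
      let v , v≡w = letters-surjective bounded
      in subst (_∈ avoiders n) v≡w (∈-map⁺ letters (∈-filter⁺ avoider? (words-complete v)
           ( letters-unique⁻ v (subst Unique (sym v≡w) unique)
           , letters-avoids⁻ v (subst Avoids132 (sym v≡w) avoids))))

    ∈-avoiders⁻ : ∀ {w} → w ∈ avoiders n → Avoider n w
    ∈-avoiders⁻ {n} w∈ with v , v∈ , refl ← ∈-map⁻ letters w∈
      with _ , v! , v-avoids ← ∈-filter⁻ avoider? {xs = words n n} v∈ =
      avoider (letters-length v) (All-letters⁺ v (λ i → Fin.toℕ<n (lookup v i)))
              (letters-unique⁺ v v!) (letters-avoids⁺ v v-avoids)

  splittingsAt : ∀ n → Fin (suc n) → List (List ℕ × List ℕ)
  splittingsAt n i = cartesianProduct (avoiders (toℕ i)) (avoiders (n ∸ toℕ i))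

  splittings : ℕ → List (List ℕ × List ℕ)
  splittings n = concat (tabulate (splittingsAt n))

  ∈-splittingsAt⁻ : ∀ {L R} i → (L , R) ∈ splittingsAt n i → Avoider (toℕ i) L × Avoider (n ∸ toℕ i) R
  ∈-splittingsAt⁻ {n} i LR∈ =
    let L∈ , R∈ = ∈-cartesianProduct⁻ (avoiders (toℕ i)) (avoiders (n ∸ toℕ i)) LR∈
    in ∈-avoiders⁻ L∈ , ∈-avoiders⁻ R∈

  ∈-splittings⁺ : ∀ {L R} → Avoider k L → Avoider l R → (L , R) ∈ splittings (k + l)
  ∈-splittings⁺ {k} {l} L-avoider R-avoider = ∈-concat⁺′
    (∈-cartesianProduct⁺
      (∈-avoiders⁺ (subst (λ i → Avoider i _) (sym k≡) L-avoider))
      (∈-avoiders⁺ (subst (λ i → Avoider i _) (sym l≡) R-avoider)))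
    (∈-tabulate⁺ {f = splittingsAt (k + l)} i)
    where
    i : Fin (suc (k + l))
    i = fromℕ< (s≤s (ℕ.m≤m+n k l))

    k≡ : toℕ i ≡ k
    k≡ = Fin.toℕ-fromℕ< (s≤s (ℕ.m≤m+n k l))

    l≡ : k + l ∸ toℕ i ≡ l
    l≡ = trans (cong (k + l ∸_) k≡) (ℕ.m+n∸m≡n k l)

  ∈-splittings⁻ : ∀ {L R} → (L , R) ∈ splittings n → ∃₂ λ k l → k + l ≡ n × Avoider k L × Avoider l R
  ∈-splittings⁻ {n} LR∈
    with _ , LR∈i , i∈ ← ∈-concat⁻′ (tabulate (splittingsAt n)) LR∈
    with i , refl ← ∈-tabulate⁻ {f = splittingsAt n} i∈ =
    toℕ i , n ∸ toℕ i , ℕ.m+[n∸m]≡n (s≤s⁻¹ (Fin.toℕ<n i)) , ∈-splittingsAt⁻ i LR∈i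

  splittings-unique : ∀ n → Unique (splittings n)
  splittings-unique n = Unique.concat⁺
    (All.tabulate⁺ (λ i → Unique.cartesianProduct⁺ (avoiders-unique (toℕ i)) (avoiders-unique (n ∸ toℕ i))))
    -- Blocks for different indices are disjoint, since the index is the length of the left part.
    (AllPairs.tabulate⁺ (λ i≢j (LR∈i , LR∈j) → i≢j (Fin.toℕ-injective (trans
      (sym (Avoider.length≡ (proj₁ (∈-splittingsAt⁻ _ LR∈i))))
      (Avoider.length≡ (proj₁ (∈-splittingsAt⁻ _ LR∈j)))))))

  -- Injectivity is asked only on members of the list, because `glue-injective` concerns avoiders of
  -- a fixed total size.
  map-unique : {f : A → B} {xs : List A} → (∀ {x y} → x ∈ xs → y ∈ xs → f x ≡ f y → x ≡ y) →
               Unique xs → Unique (map f xs)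
  map-unique {xs = []}     f-inj []         = []
  map-unique {xs = x ∷ xs} f-inj (x∉xs ∷ xs!) =
    All.map⁺ (All.tabulate λ y∈xs fx≡fy → All.lookup x∉xs y∈xs (f-inj (here refl) (there y∈xs) fx≡fy))
    ∷ map-unique (λ x∈ y∈ → f-inj (there x∈) (there y∈)) xs!

  -- The decomposition as a bijection: neither list has repetitions, and `unglue` and `glue-avoider`
  -- show that they have the same members.
  avoiders-suc : ∀ n → avoiders (suc n) ↭ map (uncurry glue) (splittings n)
  avoiders-suc n = ∼bag⇒↭ (unique∧set⇒bag (avoiders-unique (suc n))
    (map-unique glue-inj (splittings-unique n)) (mk⇔ to from))
    where
    glue-inj : ∀ {LR LR′} → LR ∈ splittings n → LR′ ∈ splittings n →
               uncurry glue LR ≡ uncurry glue LR′ → LR ≡ LR′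
    glue-inj LR∈ LR′∈ eq
      with k , l , k+l≡n , aL , aR ← ∈-splittings⁻ {n} LR∈
         | k′ , l′ , k′+l′≡n , aL′ , aR′ ← ∈-splittings⁻ {n} LR′∈
      with refl , refl ← glue-injective (trans k+l≡n (sym k′+l′≡n)) aL aR aL′ aR′ eq = refl

    to : ∀ {w} → w ∈ avoiders (suc n) → w ∈ map (uncurry glue) (splittings n)
    to w∈ with L , R , aL , aR , refl , refl ← unglue (∈-avoiders⁻ w∈) =
      ∈-map⁺ (uncurry glue) (∈-splittings⁺ aL aR)

    from : ∀ {w} → w ∈ map (uncurry glue) (splittings n) → w ∈ avoiders (suc n)
    from w∈ with (L , R) , LR∈ , refl ← ∈-map⁻ (uncurry glue) w∈
      with k , l , refl , aL , aR ← ∈-splittings⁻ {n} LR∈ = ∈-avoiders⁺ (glue-avoider aL aR)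

open Permutations

-- Generating functions and their functional equations.

module GeneratingFunctions {c ℓ} (R : CommutativeRing c ℓ) (Y : CommutativeRing.Carrier R) where
  private
    module P = CommutativeRing R
    module R⟦x⟧ = PowerSeries R
    module S = CommutativeRing R⟦x⟧.commutativeRing
    module S^ = RawSemiringDefs (RawRing.rawSemiring S.rawRing)

  open WeightedSum R
  open RawSemiringDefs (RawRing.rawSemiring P.rawRing) using (_^_) renaming (_×_ to _·_)
  open Exp P.semiring using (^-homo-*; ^-congʳ)
  open Mult P.semiring using (×-homo-+; ×-congˡ; ×-congʳ; ×-comm-*; ×-homo-1)
  open GroupProperties P.+-group using (//-rightDividesˡ)

  x y z : S.Carrier
  x = indeterminate P.rawRing
  y = constant P.rawRing Y
  z = constant P.rawRing (Y P.- P.1#)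

  weight descentWeight singletonWeight extendedWeight : List ℕ → P.Carrier
  weight          w = Y ^ occ213 w
  descentWeight   w = finalDescent w · weight w
  singletonWeight w = isSingleton w · weight w
  extendedWeight  w = Y ^ (occ213 w ℕ.+ finalDescent w)

  gf : (List ℕ → P.Carrier) → S.Carrier
  gf h n = wsum h (avoiders n)

  F A D : S.Carrier
  F = gf weight
  A = gf extendedWeight
  D = gf descentWeight

  gf-+ : ∀ g h → gf (λ w → g w P.+ h w) S.≈ gf g S.+ gf h
  gf-+ g h n = wsum-+ (avoiders n)

  -- The decomposition as an equation of series: the empty word gives the constant term, the maximum
  -- gives the factor `x`, and a weight that factors over `glue` gives a Cauchy product.
  gf-glue : ∀ {g h h′} →
    (∀ {k l L R} → Avoider k L → Avoider l R → g (glue L R) P.≈ h L P.* h′ R) →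
    gf g S.≈ constant P.rawRing (g []) S.+ x S.* (gf h S.* gf h′)
  gf-glue {g} {h} {h′} g-glue zero = begin
    gf g 0                               ≡⟨ cong (wsum g) avoiders-0 ⟩
    g [] P.+ P.0#                        ≈⟨ P.+-congˡ (R⟦x⟧.indeterminate-*-zero (gf h S.* gf h′)) ⟨
    g [] P.+ (x S.* (gf h S.* gf h′)) 0  ∎
    where open ≈-Reasoning P.setoid
  gf-glue {g} {h} {h′} g-glue (suc n) = begin
    gf g (suc n)
      ≈⟨ wsum-↭ (avoiders-suc n) ⟩
    wsum g (map (uncurry glue) (splittings n))
      ≈⟨ wsum-map (uncurry glue) (splittings n) ⟩
    wsum (g ∘ uncurry glue) (splittings n)
      ≈⟨ wsum-cong (λ LR∈ → let _ , _ , _ , aL , aR = ∈-splittings⁻ {n} LR∈ in g-glue aL aR) ⟩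
    wsum (λ (L , R) → h L P.* h′ R) (splittings n)
      ≈⟨ wsum-concat-tabulate (splittingsAt n) ⟩
    (sum λ i → wsum (λ (L , R) → h L P.* h′ R) (splittingsAt n i))
      ≈⟨ sum-cong-≋ {suc n} (λ i → wsum-cartesianProduct {g = h} {h′} (avoiders (toℕ i)) (avoiders (n ∸ toℕ i))) ⟩
    (gf h S.* gf h′) n
      ≈⟨ R⟦x⟧.indeterminate-*-suc (gf h S.* gf h′) n ⟨
    (x S.* (gf h S.* gf h′)) (suc n)
      ≈⟨ P.+-identityˡ _ ⟨
    P.0# P.+ (x S.* (gf h S.* gf h′)) (suc n)  ∎
    where
    open ≈-Reasoning P.setoid
    open Sum P.semiring using (sum; sum-cong-≋)

  -- For e equal to 0 or 1, the power Y^e is 1 + (Y - 1)e; here e is `finalDescent w`.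
  extendedWeight-split : ∀ w → extendedWeight w P.≈ weight w P.+ (Y P.- P.1#) P.* descentWeight w
  extendedWeight-split w with finalDescent w | finalDescent-0∨1 w
  ... | _ | inj₁ ≡.refl = begin
    Y ^ (occ213 w ℕ.+ 0)                ≈⟨ ^-congʳ Y (ℕ.+-identityʳ (occ213 w)) ⟩
    weight w                            ≈⟨ P.+-identityʳ _ ⟨
    weight w P.+ P.0#                   ≈⟨ P.+-congˡ (P.zeroʳ _) ⟨
    weight w P.+ (Y P.- P.1#) P.* P.0#  ∎
    where open ≈-Reasoning P.setoid
  ... | _ | inj₂ ≡.refl = begin
    Y ^ (occ213 w ℕ.+ 1)                             ≈⟨ ^-congʳ Y (ℕ.+-comm (occ213 w) 1) ⟩
    Y P.* weight w                                   ≈⟨ P.*-congʳ (//-rightDividesˡ P.1# Y) ⟨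
    (Y P.- P.1# P.+ P.1#) P.* weight w               ≈⟨ P.distribʳ _ _ _ ⟩
    (Y P.- P.1#) P.* weight w P.+ P.1# P.* weight w  ≈⟨ P.+-comm _ _ ⟩
    P.1# P.* weight w P.+ (Y P.- P.1#) P.* weight w  ≈⟨ P.+-cong (P.*-identityˡ _)
                                                          (P.*-congˡ (P.sym (×-homo-1 (weight w)))) ⟩
    weight w P.+ (Y P.- P.1#) P.* (1 · weight w)        ∎
    where open ≈-Reasoning P.setoid

  weight-glue : ∀ {k l L R} → Avoider k L → Avoider l R →
                weight (glue L R) P.≈ extendedWeight L P.* weight R
  weight-glue {L = L} {R} aL aR =
    P.trans (^-congʳ Y (glue-occ213 aL aR)) (^-homo-* Y (occ213 L ℕ.+ finalDescent L) (occ213 R))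

  descentWeight-glue : ∀ {k l L R} → Avoider k L → Avoider l R →
    descentWeight (glue L R) P.≈ extendedWeight L P.* (descentWeight R P.+ singletonWeight R)
  descentWeight-glue {L = L} {R} aL aR = begin
    finalDescent (glue L R) · weight (glue L R)
      ≈⟨ ×-congˡ (glue-finalDescent aL aR) ⟩
    (finalDescent R ℕ.+ isSingleton R) · weight (glue L R)
      ≈⟨ ×-congʳ (finalDescent R ℕ.+ isSingleton R) (weight-glue aL aR) ⟩
    (finalDescent R ℕ.+ isSingleton R) · (extendedWeight L P.* weight R)
      ≈⟨ ×-comm-* (finalDescent R ℕ.+ isSingleton R) (extendedWeight L) (weight R) ⟨
    extendedWeight L P.* ((finalDescent R ℕ.+ isSingleton R) · weight R)
      ≈⟨ P.*-congˡ (×-homo-+ (weight R) (finalDescent R) (isSingleton R)) ⟩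
    extendedWeight L P.* (descentWeight R P.+ singletonWeight R)  ∎
    where open ≈-Reasoning P.setoid

  -- Only the permutation of size 1 contributes, and it has no occurrence of 213.
  gf-singletonWeight : gf singletonWeight S.≈ x
  gf-singletonWeight zero          = P.trans (P.reflexive (cong (wsum singletonWeight) avoiders-0)) (P.+-identityʳ P.0#)
  gf-singletonWeight (suc zero)    = P.trans (P.reflexive (cong (wsum singletonWeight) avoiders-1))
    (P.trans (P.+-identityʳ _) (P.+-identityʳ P.1#))
  gf-singletonWeight (suc (suc n)) = wsum-0 λ {w} w∈ → ×-congˡ (not-singleton w (Avoider.length≡ (∈-avoiders⁻ w∈)))
    where
    not-singleton : ∀ w → length w ≡ suc (suc n) → isSingleton w ≡ 0
    not-singleton (_ ∷ _ ∷ _) _ = ≡.refl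

  z+1≈y : z S.+ S.1# S.≈ y
  z+1≈y zero    = //-rightDividesˡ P.1# Y
  z+1≈y (suc n) = P.+-identityʳ P.0#

  F-equation : F S.≈ S.1# S.+ x S.* (A S.* F)
  F-equation = gf-glue weight-glue

  D-equation : D S.≈ x S.* (A S.* (D S.+ x))
  D-equation = begin
    D
      ≈⟨ gf-glue descentWeight-glue ⟩
    constant P.rawRing P.0# S.+ x S.* (A S.* gf (λ w → descentWeight w P.+ singletonWeight w))
      -- The constant term vanishes because the empty word has no final descent.
      ≈⟨ S.+-cong (λ { zero → P.refl ; (suc _) → P.refl })
           (S.*-congˡ {x} (S.*-congˡ {A} (S.trans (gf-+ descentWeight singletonWeight)
                                                  (S.+-congˡ {D} gf-singletonWeight)))) ⟩
    S.0# S.+ x S.* (A S.* (D S.+ x))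
      ≈⟨ S.+-identityˡ (x S.* (A S.* (D S.+ x))) ⟩
    x S.* (A S.* (D S.+ x))  ∎
    where open ≈-Reasoning S.setoid

  A-equation : A S.≈ F S.+ z S.* D
  A-equation n = begin
    wsum extendedWeight (avoiders n)
      ≈⟨ wsum-cong {xs = avoiders n} (λ {w} _ → extendedWeight-split w) ⟩
    wsum (λ w → weight w P.+ (Y P.- P.1#) P.* descentWeight w) (avoiders n)
      ≈⟨ wsum-+ (avoiders n) ⟩
    F n P.+ wsum (λ w → (Y P.- P.1#) P.* descentWeight w) (avoiders n)
      ≈⟨ P.+-congˡ (wsum-*ˡ (Y P.- P.1#) (avoiders n)) ⟩
    F n P.+ (Y P.- P.1#) P.* D n
      ≈⟨ P.+-congˡ (R⟦x⟧.constant-* (Y P.- P.1#) D n) ⟨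
    F n P.+ (z S.* D) n  ∎
    where open ≈-Reasoning P.setoid

  √Δ : S.Carrier
  √Δ = QuadraticEquation.√Δ R⟦x⟧.commutativeRing x y F

  solution : ∀ {G} → G S.≈ F →
    IsSolution S._≈_ S._+_ S._*_ S._-_ S^._^_ S^._×_ S.1# x y G √Δ
  solution {G} G≈F = QuadraticEquation.solution R⟦x⟧.commutativeRing x y z z+1≈y {G} {F} {A} {D}
                       G≈F F-equation D-equation A-equation

-- The polynomial ring in y.

module ℤ⟦y⟧ = PowerSeries ℤ.+-*-commutativeRing

-- Polynomials are compared by their coefficients, so `coeff` is an injective homomorphism into
-- power series in y and the ring laws are pulled back along it.
ℤ[y]-commutativeRing : CommutativeRing _ _
ℤ[y]-commutativeRing = record
  { RawRing ℤ[y]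
  ; isCommutativeRing =
      RingMonomorphism.isCommutativeRing coeff-isRingMonomorphism
        (CommutativeRing.isCommutativeRing ℤ⟦y⟧.commutativeRing)
  }
  where
  coeff-isRingMonomorphism : IsRingMonomorphism ℤ[y] ℤ⟦y⟧ coeff
  coeff-isRingMonomorphism = record
    { isRingHomomorphism = record
      { isSemiringHomomorphism = record
        { isNearSemiringHomomorphism = record
          { +-isMonoidHomomorphism = record
            { isMagmaHomomorphism = record
              { isRelHomomorphism = record { cong = λ p≈q → p≈q }
              ; homo = λ _ _ _ → ≡.refl
              }
            ; ε-homo = λ _ → ≡.refl
            }
          ; *-homo = λ _ _ _ → ≡.refl
          }
        ; 1#-homo = λ _ → ≡.refl
        }
      ; -‿homo = λ _ _ → ≡.refl
      }
    ; injective = λ p≈q → p≈q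
    }

module ℤ[y]⟦x⟧ = PowerSeries ℤ[y]-commutativeRing

-- Coefficients of the generating function and the closed form.

open import Data.Integer.Base using (+_)
open Defs using (_+_; _*_; _-_; 0#; 1#; _≈_; _≉_; _^_; _·_; x; y)

Y : Polynomial
Y = y 0

private
  module P  = CommutativeRing ℤ[y]-commutativeRing
  module PS = RawSemiringDefs (RawRing.rawSemiring ℤ[y])

open WeightedSum ℤ[y]-commutativeRing using (wsum; wsum-map)
module GF = GeneratingFunctions ℤ[y]-commutativeRing Y

-- Multiplication by `Y` shifts coefficients by one.
coeff-Y^ : ∀ k r → coeff (Y PS.^ k) r ≡ + indicator (k ≟ r)
coeff-Y^ zero    zero    = ≡.refl
coeff-Y^ zero    (suc r) = ≡.refl
coeff-Y^ (suc k) zero    = ℤ⟦y⟧.indeterminate-*-zero (coeff (Y PS.^ k))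
coeff-Y^ (suc k) (suc r) = ≡.trans (ℤ⟦y⟧.indeterminate-*-suc (coeff (Y PS.^ k)) r) (coeff-Y^ k r)

-- A summand contributes 1 to the coefficient of y^r if its exponent is r, and 0 otherwise, so
-- extracting that coefficient is counting.
coeff-wsum-Y^ : ∀ {a p q} {A : Set a} {P : Pred A p} {Q : Pred A q} (P? : Decidable P) (Q? : Decidable Q)
  (s : A → ℕ) r → (∀ a → (P a × s a ≡ r) ⇔ Q a) → ∀ as →
  coeff (wsum (λ a → Y PS.^ s a) (filter P? as)) r ≡ + length (filter Q? as)
coeff-wsum-Y^ P? Q? s r P×s≡r⇔Q []       = ≡.refl
coeff-wsum-Y^ P? Q? s r P×s≡r⇔Q (a ∷ as) with P? a
... | no ¬Pa = ≡.trans (coeff-wsum-Y^ P? Q? s r P×s≡r⇔Q as)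
  (cong (+_ ∘ length) (≡.sym (List.filter-reject Q? {xs = as} (¬Pa ∘ proj₁ ∘ Equivalence.from (P×s≡r⇔Q a)))))
... | yes Pa = begin
  coeff (Y PS.^ s a) r ℤ.+ coeff (wsum (λ a → Y PS.^ s a) (filter P? as)) r
    ≡⟨ cong₂ ℤ._+_ (coeff-Y^ (s a) r) (coeff-wsum-Y^ P? Q? s r P×s≡r⇔Q as) ⟩
  + (indicator (s a ≟ r) ℕ.+ length (filter Q? as))
    ≡⟨ cong (λ i → + (i ℕ.+ length (filter Q? as)))
         (indicator-⇔ (mk⇔ (λ eq → Equivalence.to (P×s≡r⇔Q a) (Pa , eq))
                           (proj₂ ∘ Equivalence.from (P×s≡r⇔Q a)))
                      (s a ≟ r) (Q? a)) ⟩
  + (indicator (Q? a) ℕ.+ length (filter Q? as))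
    ≡⟨ cong +_ (length-filter-∷ Q?) ⟨
  + length (filter Q? (a ∷ as))  ∎
  where open ≡-Reasoning

opaque
  unfolding avoiders

  -- `f₂₁₃` filters all words anew for every r, while `GF.F` lists the avoiders once and records r
  -- as an exponent; coefficient extraction reconciles the two.
  F₂₁₃≈gf : F₂₁₃ ≈ GF.F
  F₂₁₃≈gf n r = ≡.sym (≡.trans
    (wsum-map letters (filter avoider? (words n n)) r)
    (coeff-wsum-Y^ avoider? (counted? r) (occ213 ∘ letters) r
      (λ v → mk⇔ (λ ((v! , v-avoids) , eq) → v! , v-avoids , ≡.trans (occ213-letters v) eq)
                 (λ (v! , v-avoids , eq) → (v! , v-avoids) , ≡.trans (≡.sym (occ213-letters v)) eq))
      (words n n)))

sqrt : Series
sqrt = GF.√Δ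

solution : IsSolution _≈_ _+_ _*_ _-_ _^_ _·_ 1# x y F₂₁₃ sqrt
solution = GF.solution {F₂₁₃} F₂₁₃≈gf

theorem3p3 : ∃[ √Δ ]
    (IsSqrt (1# + 2 · x ^ 2 - 2 · x ^ 2 * y + x ^ 4 - 2 · x ^ 4 * y + x ^ 4 * y ^ 2 - 4 · x) √Δ
    × F₂₁₃ ≈ (1# - x ^ 2 + x ^ 2 * y - √Δ) / (2 · x * (1# + x * y - x)))
theorem3p3 = sqrt , (IsSolution.square solution , sqrt-0) , denominator≉0 , IsSolution.quotient solution
  where
  sqrt-0 : sqrt 0 P.≈ P.1#
  sqrt-0 = let w , s≈1+xw = IsSolution.constant-term solution in
    P.trans {sqrt 0} {(1# + x * w) 0} {P.1#} (s≈1+xw 0) (P.trans {(1# + x * w) 0} {P.1# P.+ P.0#} {P.1#}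
      (P.+-congˡ {P.1#} {(x * w) 0} {P.0#} (ℤ[y]⟦x⟧.indeterminate-*-zero w)) (P.+-identityʳ P.1#))

  denominator≉0 : 2 · x * (1# + x * y - x) ≉ 0#
  -- The coefficient of x¹y⁰ in the denominator is 2.
  denominator≉0 b≈0 = case b≈0 1 0 of λ ()
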